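{- Let $\alpha \ge 2$ be an integer. Every finite simple graph $G$ with vertex-edge diameter $d_{ve}(G)=3$ and independence number $\alpha(G)=\alpha$ satisfies $P(G)\le 2\alpha+1$, and there exists a graph of diameter $3$ with vertex-edge diameter $3$ and independence number $\alpha$ whose pegging number is exactly $2\alpha+1$; thus the maximum pegging number of such graphs is $2\alpha+1$. Furthermore, if $G$ has $d_{ve}(G)=3$ and $\alpha(G)=\alpha$, then for every distribution of at least $2\alpha+1$ pegs on $G$ and every vertex $t$, a peg can be placed on $t$ using at most $7$ pegging moves.
   Context: All graphs are finite and simple. A graph is non-null if it has at least one edge. The distance between a vertex $x$ and an edge $e$ is the minimum distance from $x$ to an endpoint of $e$; the vertex-edge diameter $d_{ve}(G)$ of a non-null graph $G$ is the maximum distance between a vertex and an edge of $G$. $\alpha(G)$ denotes the independence number. A distribution of pegs on $G$ is a subset $D \subseteq V(G)$. If $u,v \in D$ are distinct adjacent vertices and $w \notin D$ is a vertex adjacent to $v$, the pegging move (jumping $u$ over $v$ into $w$) replaces $D$ by $(D\setminus\{u,v\})\cup\{w\}$. A vertex $t$ is reachable from $D$ if some finite (possibly empty) sequence of pegging moves starting from $D$ ends in a distribution containing $t$; $\mathrm{Reach}(D)$ is the set of reachable vertices. The pegging number $P(G)$ is the smallest positive integer $d$ such that every distribution of size $d$ on $G$ has reach $V(G)$. -}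

module Defs where

open import Data.Nat using (ℕ; zero; suc; _≤_; _<_; _+_; _*_)
open import Data.Bool using (Bool; true; false)
open import Data.Fin using (Fin)
open import Data.Fin.Subset using (Subset; _∈_; _∉_; ⁅_⁆; _∪_; _-_; ∣_∣)
open import Data.Product using (Σ; ∃; ∃-syntax; _×_; _,_)
open import Data.Sum using (_⊎_)
open import Relation.Binary.PropositionalEquality using (_≡_)
open import Relation.Nullary using (¬_)

record Graph (n : ℕ) : Set where
  field
    adj    : Fin n → Fin n → Bool
    sym    : ∀ x y → adj x y ≡ adj y x
    irrefl : ∀ x → adj x x ≡ false

module _ {n : ℕ} (G : Graph n) where
  open Graph G

  Adj : Fin n → Fin n → Set
  Adj x y = adj x y ≡ true

  data Walk : ℕ → Fin n → Fin n → Set where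
    here : ∀ {x} → Walk zero x x
    step : ∀ {k x y z} → Adj x y → Walk k y z → Walk (suc k) x z

  DistLe : Fin n → Fin n → ℕ → Set
  DistLe x y k = ∃[ j ] (j ≤ k × Walk j x y)

  DistEq : Fin n → Fin n → ℕ → Set
  DistEq x y d = DistLe x y d × (∀ k → DistLe x y k → d ≤ k)

  VEDistLe : Fin n → Fin n → Fin n → ℕ → Set
  VEDistLe x u v k = DistLe x u k ⊎ DistLe x v k

  NonNull : Set
  NonNull = ∃[ u ] ∃[ v ] Adj u v

  HasVEDiam : ℕ → Set
  HasVEDiam d =
    NonNull
    × (∀ x u v → Adj u v → VEDistLe x u v d)
    × (∃[ x ] ∃[ u ] ∃[ v ] (Adj u v × (∀ k → VEDistLe x u v k → d ≤ k)))

  HasDiam : ℕ → Set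
  HasDiam d = (∀ x y → DistLe x y d) × (∃[ x ] ∃[ y ] DistEq x y d)

  Independent : Subset n → Set
  Independent S = ∀ x y → x ∈ S → y ∈ S → ¬ Adj x y

  HasIndepNum : ℕ → Set
  HasIndepNum a =
    (∃[ S ] (Independent S × ∣ S ∣ ≡ a)) × (∀ S → Independent S → ∣ S ∣ ≤ a)

  Move : Subset n → Subset n → Set
  Move D D' = ∃[ u ] ∃[ v ] ∃[ w ]
    (u ∈ D × v ∈ D × Adj u v × w ∉ D × Adj v w × D' ≡ ((D - u) - v) ∪ ⁅ w ⁆)

  data Moves : ℕ → Subset n → Subset n → Set where
    done : ∀ {D} → Moves zero D D
    more : ∀ {k D D' D''} → Move D D' → Moves k D' D'' → Moves (suc k) D D''

  Reachable : Subset n → Fin n → Set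
  Reachable D t = ∃[ k ] ∃[ D' ] (Moves k D D' × t ∈ D')

  ReachableWithin : ℕ → Subset n → Fin n → Set
  ReachableWithin m D t = ∃[ k ] ∃[ D' ] (k ≤ m × Moves k D D' × t ∈ D')

  AllReach : ℕ → Set
  AllReach d = ∀ D → ∣ D ∣ ≡ d → ∀ t → Reachable D t

  HasPeggingNum : ℕ → Set
  HasPeggingNum p = 1 ≤ p × AllReach p × (∀ d → 1 ≤ d → d < p → ¬ AllReach d)

{-# OPTIONS --safe #-}
module Submission where

-- Upper bound.  Distribute 2α + 1 pegs and fix t.  A pegged edge at distance 3 from a vertex o
-- can be traded for a peg at distance 2 from o; two such tokens, or a token and a leftover peg,
-- that are adjacent or equal put a peg next to o, and pairwise non-adjacent tokens together with o
-- form an independent set.  So a matching of the pegs with enough tokens first pegs a neighbour x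
-- of t (3 moves), then, aiming at x, another neighbour of x (3 moves), and the last jump lands on t.
-- The count fails only if every maximal matching is near-perfect.  Then the pegs contain a path on
-- four vertices, which alone pegs a vertex next to any o; two disjoint ones suffice, and otherwise
-- the remaining pegs are a triangle and disjoint edges, a case settled by maximality of explicit
-- independent sets.
--
-- Lower bound.  Take α cliques, any two of them joined by a single edge between two gate vertices,
-- with four pegs on non-gate vertices of one clique, two in each of the others, and none in the
-- clique of t.  A clique holding at most one peg, or only two non-gate pegs, can never export a peg,
-- and the surplus of the first clique is used up by the time one peg arrives in the clique of t.

open import Defs
open import Data.Bool using (true)
import Data.Bool.Properties as Bool
open import Data.Empty using (⊥-elim) renaming (⊥ to False)
open import Data.Fin using (Fin; zero; suc; splitAt; remQuot; combine; _↑ˡ_; _↑ʳ_)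
import Data.Fin.Properties as Fin
open import Data.Fin.Subset using (Subset; inside; outside; _∈_; _∉_; ⁅_⁆; _∪_; _-_; ∣_∣; ⊥)
import Data.Fin.Subset.Properties as Sub
open import Data.List using (List; []; _∷_; _++_; length; map; [_]; allFin)
import Data.List.Properties as List
open import Data.List.Membership.Propositional using (find) renaming (_∈_ to _∈ₗ_; _∉_ to _∉ₗ_)
open import Data.List.Membership.Propositional.Properties using (∈-∃++; ∈-++⁺ˡ; ∈-map⁻)
open import Data.List.Relation.Binary.Permutation.Propositional using (_↭_; refl; prep; swap; trans; ↭-sym; ↭-refl; ↭-trans; ↭-reflexive)
open import Data.List.Relation.Binary.Permutation.Propositional.Properties using (All-resp-↭; ∈-resp-↭; ++⁺; ++⁺ˡ; ++⁺ʳ; shift; shifts; ↭-length; ↭-reverse)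
open import Data.List.Relation.Unary.All using (All; []; _∷_)
import Data.List.Relation.Unary.All as All
import Data.List.Relation.Unary.All.Properties as Allₚ
open import Data.List.Relation.Unary.AllPairs using (AllPairs; []; _∷_)
import Data.List.Relation.Unary.AllPairs as AllPairs
import Data.List.Relation.Unary.AllPairs.Properties as AllPairsₚ
open import Data.List.Relation.Unary.Any using (here; there; _─_)
import Data.List.Relation.Unary.Any as Any
open import Data.List.Relation.Unary.Unique.Propositional using (Unique)
import Data.List.Relation.Unary.Unique.Propositional.Properties as Uniqueₚ
open import Data.Nat using (ℕ; zero; suc; _≤_; _<_; _+_; _*_; z≤n; s≤s; s≤s⁻¹)
import Data.Nat.Properties as ℕ
open import Data.Product using (Σ; ∃-syntax; _×_; _,_; proj₁; proj₂; uncurry)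
open import Data.Sum using (_⊎_; inj₁; inj₂)
open import Data.Unit using (⊤; tt)
open import Data.Vec using ([]; _∷_)
import Data.Vec as Vec
open import Function.Bundles using (mk⇔)
open import Relation.Binary.PropositionalEquality using (_≡_; _≢_; refl; sym; cong; subst)
import Relation.Binary.PropositionalEquality as ≡
open import Relation.Nullary using (¬_; Dec; yes; no; does)
open import Relation.Nullary.Decidable using (map′; _×-dec_; _⊎-dec_; ¬?; decidable-stable; dec-true; dec-false; does-⇔)

-- Permutations, selections and deletions in lists.

allPairs-resp-↭ : {A : Set} {R : A → A → Set} → (∀ {x y} → R x y → R y x) →
  ∀ {xs ys} → xs ↭ ys → AllPairs R xs → AllPairs R ys
allPairs-resp-↭ s refl rs = rs
allPairs-resp-↭ s (prep x p) (r ∷ rs) = All-resp-↭ p r ∷ allPairs-resp-↭ s p rs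
allPairs-resp-↭ s (swap x y p) ((rxy ∷ rx) ∷ (ry ∷ rs)) =
  (s rxy ∷ All-resp-↭ p ry) ∷ (All-resp-↭ p rx ∷ allPairs-resp-↭ s p rs)
allPairs-resp-↭ s (trans p q) rs = allPairs-resp-↭ s q (allPairs-resp-↭ s p rs)

unique-resp-↭ : {A : Set} {xs ys : List A} → xs ↭ ys → Unique xs → Unique ys
unique-resp-↭ = allPairs-resp-↭ (λ ne eq → ne (sym eq))

∈⇒↭ : {A : Set} {x : A} {xs : List A} → x ∈ₗ xs → ∃[ ys ] xs ↭ x ∷ ys
∈⇒↭ x∈ with ys , zs , refl ← ∈-∃++ x∈ = ys ++ zs , shift _ ys zs

-- Membership in `xs` is replaced by a rearrangement of `xs` with the element in front. The rest of
-- the list stays available, which is what a game on the remaining pegs needs.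
all-by-splitting : {A : Set} {P : A → Set} (xs : List A) →
  (∀ {x ys} → xs ↭ x ∷ ys → P x) → All P xs
all-by-splitting [] f = []
all-by-splitting (x ∷ xs) f =
  f ↭-refl ∷ all-by-splitting xs (λ p → f (↭-trans (prep x p) (swap x _ ↭-refl)))

allPairs-by-splitting : {A : Set} {R : A → A → Set} (xs : List A) →
  (∀ {x y ys} → xs ↭ x ∷ y ∷ ys → R x y) → AllPairs R xs
allPairs-by-splitting [] f = []
allPairs-by-splitting (x ∷ xs) f =
  all-by-splitting xs (λ p → f (prep x p)) ∷
  allPairs-by-splitting xs (λ p → f (↭-trans (prep x p)
    (↭-trans (swap x _ ↭-refl) (prep _ (swap x _ ↭-refl)))))

-- The provenance of every chosen `y` is returned as well, so that facts about the source carry over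
-- to the choice.
choose : {A B : Set} {R : A → B → Set} {S : B → B → Set} {xs : List A} →
  All (λ x → ∃[ y ] R x y) xs → AllPairs (λ x x' → ∀ {y z} → R x y → R x' z → S y z) xs →
  ∃[ ys ] (length ys ≡ length xs × AllPairs S ys × All (λ y → ∃[ x ] (x ∈ₗ xs × R x y)) ys)
choose [] [] = [] , refl , [] , []
choose {xs = x ∷ xs} ((y , r) ∷ rs) (s ∷ ss) with ys , len , seps , from ← choose rs ss =
  y ∷ ys , cong suc len , All.map (λ (x' , x'∈ , r') → All.lookup s x'∈ r r') from ∷ seps ,
  (x , here refl , r) ∷ All.map (λ (x' , x'∈ , r') → x' , there x'∈ , r') from

─-distinct : {A : Set} {x : A} {xs : List A} → Unique xs → (i : x ∈ₗ xs) → All (x ≢_) (xs ─ i)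
─-distinct (ne ∷ u) (here refl) = ne
─-distinct (ne ∷ u) (there i) =
  (λ eq → All.lookup ne i (sym eq)) ∷ ─-distinct u i

─-unique : {A : Set} {x : A} {xs : List A} → Unique xs → (i : x ∈ₗ xs) → Unique (xs ─ i)
─-unique (ne ∷ u) (here refl) = u
─-unique (ne ∷ u) (there i) = Allₚ.─⁺ i ne ∷ ─-unique u i

-- Subsets as duplicate-free lists.

fromList : ∀ {n} → List (Fin n) → Subset n
fromList [] = ⊥
fromList (x ∷ xs) = ⁅ x ⁆ ∪ fromList xs

∈-fromList⁻ : ∀ {n} {x : Fin n} xs → x ∈ fromList xs → x ∈ₗ xs
∈-fromList⁻ [] x∈ = ⊥-elim (Sub.∉⊥ x∈)
∈-fromList⁻ (y ∷ ys) x∈ with Sub.x∈p∪q⁻ ⁅ y ⁆ (fromList ys) x∈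
... | inj₁ p = here (Sub.x∈⁅y⁆⇒x≡y y p)
... | inj₂ p = there (∈-fromList⁻ ys p)

length≤∣fromList∣ : ∀ {n} {xs : List (Fin n)} → Unique xs → length xs ≤ ∣ fromList xs ∣
length≤∣fromList∣ [] = z≤n
length≤∣fromList∣ {xs = x ∷ xs} (ne ∷ u) =
  ℕ.≤-trans (s≤s (length≤∣fromList∣ u))
    (Sub.p⊂q⇒∣p∣<∣q∣ (Sub.q⊆p∪q ⁅ x ⁆ (fromList xs) ,
      x , Sub.x∈p∪q⁺ (inj₁ (Sub.x∈⁅x⁆ x)) , λ x∈ → All.lookup ne (∈-fromList⁻ xs x∈) refl))

elements : ∀ {n} → Subset n → List (Fin n)
elements [] = []
elements (inside ∷ p) = zero ∷ map suc (elements p)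
elements (outside ∷ p) = map suc (elements p)

elements-∈ : ∀ {n} (p : Subset n) → All (_∈ p) (elements p)
elements-∈ [] = []
elements-∈ (inside ∷ p) = Vec.here ∷ Allₚ.map⁺ (All.map Vec.there (elements-∈ p))
elements-∈ (outside ∷ p) = Allₚ.map⁺ (All.map Vec.there (elements-∈ p))

elements-unique : ∀ {n} (p : Subset n) → Unique (elements p)
elements-unique [] = []
elements-unique (inside ∷ p) =
  Allₚ.map⁺ (All.universal (λ _ ()) _) ∷
  AllPairsₚ.map⁺ (AllPairs.map (λ ne eq → ne (Fin.suc-injective eq)) (elements-unique p))
elements-unique (outside ∷ p) =
  AllPairsₚ.map⁺ (AllPairs.map (λ ne eq → ne (Fin.suc-injective eq)) (elements-unique p))

length-elements : ∀ {n} (p : Subset n) → length (elements p) ≡ ∣ p ∣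
length-elements [] = refl
length-elements (inside ∷ p) = cong suc (≡.trans (List.length-map suc (elements p)) (length-elements p))
length-elements (outside ∷ p) = ≡.trans (List.length-map suc (elements p)) (length-elements p)

∣p∪⁅x⁆∣≤1+∣p∣ : ∀ {n} (p : Subset n) x → ∣ p ∪ ⁅ x ⁆ ∣ ≤ suc ∣ p ∣
∣p∪⁅x⁆∣≤1+∣p∣ (inside ∷ p) zero rewrite Sub.∪-identityʳ p = ℕ.n≤1+n _
∣p∪⁅x⁆∣≤1+∣p∣ (outside ∷ p) zero rewrite Sub.∪-identityʳ p = ℕ.≤-refl
∣p∪⁅x⁆∣≤1+∣p∣ (inside ∷ p) (suc x) = s≤s (∣p∪⁅x⁆∣≤1+∣p∣ p x)
∣p∪⁅x⁆∣≤1+∣p∣ (outside ∷ p) (suc x) = ∣p∪⁅x⁆∣≤1+∣p∣ p x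

-- Pegging moves

module Pegging {n : ℕ} (G : Graph n) where

  V : Set
  V = Fin n

  adj? : ∀ x y → Dec (Adj G x y)
  adj? x y = Graph.adj G x y Bool.≟ true

  adj-sym : ∀ {x y} → Adj G x y → Adj G y x
  adj-sym {x} {y} e = ≡.trans (≡.sym (Graph.sym G x y)) e

  adj-irrefl : ∀ {x} → ¬ Adj G x x
  adj-irrefl {x} e with () ← ≡.trans (≡.sym e) (Graph.irrefl G x)

  adj⇒≢ : ∀ {x y} → Adj G x y → x ≢ y
  adj⇒≢ e refl = adj-irrefl e

  afterMove : Subset n → V → V → V → Subset n
  afterMove D u v w = ((D - u) - v) ∪ ⁅ w ⁆

  moves-decrease : ∀ {D D'} → Move G D D' → ∣ D' ∣ < ∣ D ∣
  moves-decrease {D} (u , v , w , u∈ , v∈ , uv , _ , _ , refl) =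
    ℕ.≤-trans (s≤s (∣p∪⁅x⁆∣≤1+∣p∣ ((D - u) - v) w))
      (ℕ.≤-trans (s≤s (Sub.x∈p⇒∣p-x∣<∣p∣ (Sub.x∈p∧x≢y⇒x∈p-y v∈ (λ eq → adj⇒≢ uv (sym eq)))))
        (Sub.x∈p⇒∣p-x∣<∣p∣ u∈))

  -- Every move costs a peg, so a search of depth `∣ D ∣` decides reachability. Decidability is what
  -- licenses the later arguments by contradiction.
  moves-bounded : ∀ {k D D'} → Moves G k D D' → k ≤ ∣ D ∣
  moves-bounded done = z≤n
  moves-bounded (more m ms) = ℕ.≤-trans (s≤s (moves-bounded ms)) (moves-decrease m)

  reachableWithin-mono : ∀ {j k D t} → j ≤ k → ReachableWithin G j D t → ReachableWithin G k D t
  reachableWithin-mono j≤k (i , D' , i≤j , ms , t∈) = i , D' , ℕ.≤-trans i≤j j≤k , ms , t∈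

  reachableNow : ∀ {k D t} → t ∈ D → ReachableWithin G k D t
  reachableNow t∈ = 0 , _ , z≤n , done , t∈

  reachableWithin? : ∀ k D t → Dec (ReachableWithin G k D t)
  reachableWithin? zero D t = map′ reachableNow (λ { (zero , _ , _ , done , t∈) → t∈ }) (t Sub.∈? D)
  reachableWithin? (suc k) D t = map′ to from
    (t Sub.∈? D ⊎-dec Fin.any? λ u → Fin.any? λ v → Fin.any? λ w →
      u Sub.∈? D ×-dec v Sub.∈? D ×-dec adj? u v ×-dec ¬? (w Sub.∈? D) ×-dec adj? v w
      ×-dec reachableWithin? k (afterMove D u v w) t)
    where
    to : _ → ReachableWithin G (suc k) D t
    to (inj₁ t∈) = reachableNow t∈
    to (inj₂ (u , v , w , u∈ , v∈ , uv , w∉ , vw , j , D' , j≤k , ms , t∈)) =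
      suc j , D' , s≤s j≤k , more (u , v , w , u∈ , v∈ , uv , w∉ , vw , refl) ms , t∈
    from : ReachableWithin G (suc k) D t → _
    from (zero , _ , _ , done , t∈) = inj₁ t∈
    from (suc j , D' , s≤s j≤k , more (u , v , w , u∈ , v∈ , uv , w∉ , vw , refl) ms , t∈) =
      inj₂ (u , v , w , u∈ , v∈ , uv , w∉ , vw , j , D' , j≤k , ms , t∈)

  reachable? : ∀ D t → Dec (Reachable G D t)
  reachable? D t = map′
    (λ (k , D' , _ , ms , t∈) → k , D' , ms , t∈)
    (λ (k , D' , ms , t∈) → k , D' , moves-bounded ms , ms , t∈)
    (reachableWithin? ∣ D ∣ D t)

  allReach? : ∀ d → Dec (AllReach G d)
  allReach? d = map′
    (λ ∄ D eq t → decidable-stable (reachable? D t) (λ ¬r → ∄ (D , eq , t , ¬r)))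
    (λ all (D , eq , t , ¬r) → ¬r (all D eq t))
    (¬? (Sub.anySubset? λ D → ∣ D ∣ ℕ.≟ d ×-dec Fin.any? λ t → ¬? (reachable? D t)))

  -- A jump onto an occupied vertex is simulated by not moving at all.
  jump : ∀ {k E t u v w} → u ∈ E → v ∈ E → Adj G u v → Adj G v w →
    (∀ E' → w ∈ E' → (∀ {z} → z ∈ E → u ≢ z → v ≢ z → z ∈ E') → ReachableWithin G k E' t) →
    ReachableWithin G (suc k) E t
  jump {E = E} {u = u} {v} {w} u∈ v∈ uv vw go with w Sub.∈? E
  ... | yes w∈ = reachableWithin-mono (ℕ.n≤1+n _) (go E w∈ (λ z∈ _ _ → z∈))
  ... | no w∉
    with j , D' , j≤k , ms , t∈ ← go (afterMove E u v w)
      (Sub.x∈p∪q⁺ (inj₂ (Sub.x∈⁅x⁆ w)))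
      (λ z∈ u≢z v≢z → Sub.x∈p∪q⁺ (inj₁ (Sub.x∈p∧x≢y⇒x∈p-y
        (Sub.x∈p∧x≢y⇒x∈p-y z∈ (λ eq → u≢z (sym eq))) (λ eq → v≢z (sym eq))))) =
    suc j , D' , s≤s j≤k , more (u , v , w , u∈ , v∈ , uv , w∉ , vw , refl) ms , t∈

  -- The list `l` records pegs that are guaranteed to be present; `E` may hold more, since a jump
  -- onto an occupied vertex is skipped and leaves its pegs in place.
  Win : ℕ → List V → V → Set
  Win k l t = Unique l → ∀ E → All (_∈ E) l → ReachableWithin G k E t

  win-mono : ∀ {j k l t} → j ≤ k → Win j l t → Win k l t
  win-mono j≤k W u E l⊆ = reachableWithin-mono j≤k (W u E l⊆)

  win-resp-↭ : ∀ {k l l' t} → l ↭ l' → Win k l t → Win k l' t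
  win-resp-↭ p W u E l⊆ = W (unique-resp-↭ (↭-sym p) u) E (All-resp-↭ (↭-sym p) l⊆)

  discard : ∀ {k l t z} (i : z ∈ₗ l) → Win k (l ─ i) t → Win k l t
  discard i W u E l⊆ = W (─-unique u i) E (Allₚ.─⁺ i l⊆)

  -- The position of `v` is taken after the deletion of `u`, so the two pegs are distinct by
  -- construction. The freshness of `w` concerns the listed pegs only and keeps the new list free of
  -- duplicates.
  play : ∀ {k l t u v w} (i : u ∈ₗ l) (j : v ∈ₗ (l ─ i)) → Adj G u v → Adj G v w →
    All (w ≢_) (l ─ i ─ j) → Win k (w ∷ (l ─ i ─ j)) t → Win (suc k) l t
  play i j uv vw fresh W un E l⊆ =
    jump (All.lookup l⊆ i) (All.lookup (Allₚ.─⁺ i l⊆) j) uv vw λ E' w∈ keep →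
      W (fresh ∷ ─-unique (─-unique un i) j) E'
        (w∈ ∷ All.zipWith (λ (z∈ , u≢ , v≢) → keep z∈ u≢ v≢)
          (Allₚ.─⁺ j (Allₚ.─⁺ i l⊆) ,
           All.zip (Allₚ.─⁺ j (─-distinct un i) , ─-distinct (─-unique un i) j)))

  capture : ∀ {k l t u v} → u ∈ₗ l → v ∈ₗ l → Adj G u v → Adj G v t → Win (suc k) l t
  capture i j uv vt un E l⊆ =
    jump (All.lookup l⊆ i) (All.lookup l⊆ j) uv vt λ E' t∈ _ → reachableNow t∈

unique-++⁻ˡ : {A : Set} (xs : List A) {ys : List A} → Unique (xs ++ ys) → Unique xs
unique-++⁻ˡ [] _ = []
unique-++⁻ˡ (x ∷ xs) (ne ∷ u) = Allₚ.++⁻ˡ xs ne ∷ unique-++⁻ˡ xs u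

unique-++⁻ʳ : {A : Set} (xs : List A) {ys : List A} → Unique (xs ++ ys) → Unique ys
unique-++⁻ʳ [] u = u
unique-++⁻ʳ (x ∷ xs) (_ ∷ u) = unique-++⁻ʳ xs u

unique-++-≢ : {A : Set} (xs : List A) {ys : List A} → Unique (xs ++ ys) →
  ∀ {x y} → x ∈ₗ xs → y ∈ₗ ys → x ≢ y
unique-++-≢ (x ∷ xs) (ne ∷ u) (here refl) y∈ = All.lookup (Allₚ.++⁻ʳ xs ne) y∈
unique-++-≢ (x ∷ xs) (_ ∷ u) (there x∈) y∈ = unique-++-≢ xs u x∈ y∈

-- Tokens and conflicts

module Tokens {n : ℕ} (G : Graph n) where
  open Pegging G

  Sep : V → V → Set
  Sep x y = x ≢ y × ¬ Adj G x y

  -- This is a walk of length two with its midpoint. That `y` is neither `o` nor a neighbour of `o`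
  -- is deduced separately, from `Quiet`.
  Dist2 : V → V → Set
  Dist2 o y = ∃[ q ] (Adj G y q × Adj G q o)

  data Item : Set where
    pair   : V → V → Item
    single : V → Item

  verts : Item → List V
  verts (pair u v) = u ∷ v ∷ []
  verts (single r) = [ r ]

  flat : List Item → List V
  flat [] = []
  flat (i ∷ is) = verts i ++ flat is

  flat-resp-↭ : ∀ {is js} → is ↭ js → flat is ↭ flat js
  flat-resp-↭ refl = ↭-refl
  flat-resp-↭ (prep i p) = ++⁺ˡ (verts i) (flat-resp-↭ p)
  flat-resp-↭ (swap i j p) =
    ↭-trans (shifts (verts i) (verts j)) (++⁺ˡ (verts j) (++⁺ˡ (verts i) (flat-resp-↭ p)))
  flat-resp-↭ (trans p q) = ↭-trans (flat-resp-↭ p) (flat-resp-↭ q)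

  Edge : Item → Set
  Edge (pair u v) = Adj G u v
  Edge (single r) = ⊤

  -- Only loose pegs need a condition: when a pair is involved, adjacent tokens are not forbidden
  -- but exploited by `conflict`.
  Unlinked : Item → Item → Set
  Unlinked (single r) (single s) = ¬ Adj G r s
  Unlinked _ _ = ⊤

  unlinked-sym : ∀ i j → Unlinked i j → Unlinked j i
  unlinked-sym (pair _ _) (pair _ _) f = f
  unlinked-sym (pair _ _) (single _) f = f
  unlinked-sym (single _) (pair _ _) f = f
  unlinked-sym (single r) (single s) na e = na (adj-sym e)

  record Valid (L : List V) (is : List Item) : Set where
    constructor valid
    field
      unique   : Unique (flat is)
      within   : All (_∈ₗ L) (flat is)
      edges    : All Edge is
      unlinked : AllPairs Unlinked is

  valid-resp-↭ : ∀ {L is js} → is ↭ js → Valid L is → Valid L js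
  valid-resp-↭ p (valid u w e a) = valid (unique-resp-↭ (flat-resp-↭ p) u)
    (All-resp-↭ (flat-resp-↭ p) w) (All-resp-↭ p e)
    (allPairs-resp-↭ (λ {i} {j} → unlinked-sym i j) p a)

  -- The cheap ways to bring a peg to `o` or next to it are ruled out: a peg at `o`, a peg beside
  -- it, or a single jump from a pegged edge onto a neighbour of `o`.
  record Quiet (o : V) (L : List V) : Set where
    field
      absent  : o ∉ₗ L
      not1    : ∀ {v} → v ∈ₗ L → ¬ Adj G v o
      not2    : ∀ {u v} → u ∈ₗ L → v ∈ₗ L → Adj G u v → ¬ Dist2 o v

  -- A token is a vertex that the item can peg: a loose peg stays, a pegged edge hops to distance
  -- two from `o`. The permutation picks the direction of the hop.
  data Token (o : V) : Item → V → Set where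
    stay : ∀ {r} → Token o (single r) r
    hop  : ∀ {u v u' v' y} → u' ∷ v' ∷ [] ↭ u ∷ v ∷ [] → Adj G u' v' → Adj G v' y → Dist2 o y →
           Token o (pair u v) y

  -- The pegs `s` are traded for one peg on `q` while the spectators `R` are untouched. The
  -- spectators may include `o` itself, because in the second stage `o` is a pegged neighbour of the
  -- target.
  Converts : V → List V → ℕ → List V → V → Set
  Converts o L m s q =
    ∀ {k R t} → All (λ z → z ∈ₗ L ⊎ z ≡ o) R → Win k (q ∷ R) t → Win (m + k) (s ++ R) t

  Strike : V → List V → ℕ → List V → Set
  Strike o L m s = ∃[ q ] (Adj G q o × Converts o L m s q)

  strike-resp-↭ : ∀ {o L m s s'} → s ↭ s' → Strike o L m s → Strike o L m s'
  strike-resp-↭ p (q , qo , f) = q , qo , λ R⊆ W → win-resp-↭ (++⁺ʳ _ p) (f R⊆ W)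

  module AtOrigin {o : V} {L : List V} (Q : Quiet o L) where
    open Quiet Q

    dist2-fresh : ∀ {u y} → u ∈ₗ L → Adj G u y → Dist2 o y → y ∉ₗ L
    dist2-fresh u∈ uy d y∈ = not2 u∈ y∈ uy d

    dist2-≢ : ∀ {u y} → u ∈ₗ L → Adj G u y → y ≢ o
    dist2-≢ u∈ uy refl = not1 u∈ uy

    fresh : ∀ {y R} → y ∉ₗ L → y ≢ o → All (λ z → z ∈ₗ L ⊎ z ≡ o) R → All (y ≢_) R
    fresh y∉ y≢o = All.map λ { (inj₁ z∈) refl → y∉ z∈ ; (inj₂ refl) eq → y≢o eq }

    nbr-fresh : ∀ {q R} → Adj G q o → All (λ z → z ∈ₗ L ⊎ z ≡ o) R → All (q ≢_) R
    nbr-fresh qo = fresh (λ q∈ → not1 q∈ qo) (adj⇒≢ qo)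

    ∉⇒≢ : ∀ {y z} → y ∉ₗ L → z ∈ₗ L → y ≢ z
    ∉⇒≢ y∉ z∈ refl = y∉ z∈

    sep-origin : ∀ {v} → v ∈ₗ L → Sep o v
    sep-origin v∈ = (λ { refl → absent v∈ }) , (λ e → not1 v∈ (adj-sym e))

    sep-dist2 : ∀ {u v y} → u ∈ₗ L → v ∈ₗ L → Adj G u v → Adj G v y → Sep o y
    sep-dist2 u∈ v∈ uv vy =
      (λ { refl → not1 v∈ vy }) , (λ e → not2 u∈ v∈ uv (_ , vy , adj-sym e))

    strike-two : ∀ {g h c y} → g ∈ₗ L → h ∈ₗ L → c ∈ₗ L → Adj G g h → Adj G h y → Adj G c y →
      ((q , _) : Dist2 o y) → Converts o L 2 (g ∷ h ∷ c ∷ []) q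
    strike-two g∈ h∈ c∈ gh hy cy d@(q , yq , qo) R⊆ W =
      let y∉ = dist2-fresh h∈ hy d in
      play (here refl) (here refl) gh hy (∉⇒≢ y∉ c∈ ∷ fresh y∉ (dist2-≢ h∈ hy) R⊆)
      (play (there (here refl)) (here refl) cy yq (nbr-fresh qo R⊆) W)

    -- v is used twice: it is vacated by the first jump and refilled by the second.
    strike-path : ∀ {p₁ p₂ v p₄ y} → All (_∈ₗ L) (p₁ ∷ p₂ ∷ v ∷ p₄ ∷ []) →
      Adj G p₁ p₂ → Adj G p₂ v → Adj G v p₄ → Adj G v y → Dist2 o y →
      Strike o L 3 (p₁ ∷ p₂ ∷ v ∷ p₄ ∷ [])
    strike-path (p₁∈ ∷ p₂∈ ∷ v∈ ∷ p₄∈ ∷ []) e₁ e₂ e₃ vy d@(q , yq , qo) = q , qo , λ R⊆ W →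
      let y∉ = dist2-fresh v∈ vy d in λ where
        un@(_ ∷ _ ∷ (_ ∷ v≢R) ∷ _) →
          (play (there (there (there (here refl)))) (there (there (here refl)))
            (adj-sym e₃) vy (∉⇒≢ y∉ p₁∈ ∷ ∉⇒≢ y∉ p₂∈ ∷ fresh y∉ (dist2-≢ v∈ vy) R⊆)
          (play (there (here refl)) (there (here refl)) e₁ e₂
            ((λ eq → ∉⇒≢ y∉ v∈ (sym eq)) ∷ v≢R)
          (play (here refl) (here refl) vy yq (nbr-fresh qo R⊆) W))) un

    -- After the hops one token peg jumps over an adjacent one onto a neighbour of `o`. Two loose
    -- pegs cannot be in conflict, being distinct and unlinked.
    conflict : ∀ {i j y z} → All (_∈ₗ L) (verts i ++ verts j) → Token o i y → Token o j z →
      Unlinked i j → Unique (verts i ++ verts j) → y ≡ z ⊎ Adj G y z →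
      Strike o L 3 (verts i ++ verts j)
    conflict _ stay stay na ((ne ∷ []) ∷ _) (inj₁ eq) = ⊥-elim (ne eq)
    conflict _ stay stay na _ (inj₂ e) = ⊥-elim (na e)
    conflict (r∈ ∷ w) (stay {r}) (hop p uv vy d) _ _ c
      with u∈ ∷ v∈ ∷ [] ← All-resp-↭ (↭-sym p) w | c
    ... | inj₁ refl = ⊥-elim (dist2-fresh v∈ vy d r∈)
    ... | inj₂ ry = strike-resp-↭ (↭-trans (shift r (_ ∷ _ ∷ []) []) (prep r p))
      (_ , proj₂ (proj₂ d) , λ R⊆ W → win-mono (ℕ.n≤1+n _) (strike-two u∈ v∈ r∈ uv vy ry d R⊆ W))
    conflict {pair a b} w (hop p uv vy d) (stay {r}) _ _ c
      with u∈ ∷ v∈ ∷ r∈ ∷ [] ← All-resp-↭ (↭-sym (++⁺ʳ [ r ] p)) w | c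
    ... | inj₁ refl = ⊥-elim (dist2-fresh v∈ vy d r∈)
    ... | inj₂ yr = strike-resp-↭ (++⁺ʳ [ r ] p)
      (_ , proj₂ (proj₂ d) ,
        λ R⊆ W → win-mono (ℕ.n≤1+n _) (strike-two u∈ v∈ r∈ uv vy (adj-sym yr) d R⊆ W))
    conflict w (hop p uv vy d@(q , yq , qo)) (hop p' uv' vy' d'@(q' , yq' , qo')) _ _ c
      with u∈ ∷ v∈ ∷ u∈' ∷ v∈' ∷ [] ← All-resp-↭ (↭-sym (++⁺ p p')) w | c
    -- Both hops would land on the same vertex, so only the first is made; the second pair's middle
    -- peg is adjacent to `y` and jumps over it onto `q`.
    ... | inj₁ refl = strike-resp-↭ (++⁺ p p') (q , qo , λ R⊆ W →
      let y∉ = dist2-fresh v∈ vy d in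
      win-mono (ℕ.n≤1+n _)
        (play (here refl) (here refl) uv vy
          (∉⇒≢ y∉ u∈' ∷ ∉⇒≢ y∉ v∈' ∷ fresh y∉ (dist2-≢ v∈ vy) R⊆)
        (discard (there (here refl))
        (play (there (here refl)) (here refl) vy' yq (nbr-fresh qo R⊆) W))))
    ... | inj₂ yz = strike-resp-↭ (++⁺ p p') (q' , qo' , λ R⊆ W →
      let y∉ = dist2-fresh v∈ vy d ; z∉ = dist2-fresh v∈' vy' d' in
        play (here refl) (here refl) uv vy
          (∉⇒≢ y∉ u∈' ∷ ∉⇒≢ y∉ v∈' ∷ fresh y∉ (dist2-≢ v∈ vy) R⊆)
        (play (there (here refl)) (there (here refl)) uv' vy'
          (adj⇒≢ (adj-sym yz) ∷ fresh z∉ (dist2-≢ v∈' vy') R⊆)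
        (play (there (here refl)) (here refl) yz yq' (nbr-fresh qo' R⊆) W)))

  module VEBounded (ve : ∀ x u v → Adj G u v → VEDistLe G x u v 3) where

    near : ∀ {o v} → DistLe G o v 3 →
      o ≡ v ⊎ Adj G v o ⊎ Dist2 o v ⊎ (∃[ y ] (Adj G v y × Dist2 o y))
    near (_ , _ , here) = inj₁ refl
    near (_ , _ , step a here) = inj₂ (inj₁ (adj-sym a))
    near (_ , _ , step a (step b here)) = inj₂ (inj₂ (inj₁ (_ , adj-sym b , adj-sym a)))
    near (_ , _ , step a (step b (step c here))) =
      inj₂ (inj₂ (inj₂ (_ , adj-sym c , _ , adj-sym b , adj-sym a)))
    near (_ , s≤s (s≤s (s≤s ())) , step _ (step _ (step _ (step _ _))))

    module _ {o : V} {L : List V} (Q : Quiet o L) where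
      open Quiet Q

      -- The bound on vertex-edge distances puts an endpoint within distance three of `o`, and
      -- `Quiet` excludes every shorter walk. The first step of the walk of length three leads to
      -- `y`.
      approach : ∀ {u v} → u ∈ₗ L → v ∈ₗ L → Adj G u v →
        ∃[ y ] ((Adj G u y ⊎ Adj G v y) × Dist2 o y)
      approach {u} {v} u∈ v∈ uv with ve o u v uv
      ... | inj₁ d with near d
      ...   | inj₁ refl = ⊥-elim (absent u∈)
      ...   | inj₂ (inj₁ e) = ⊥-elim (not1 u∈ e)
      ...   | inj₂ (inj₂ (inj₁ e)) = ⊥-elim (not2 v∈ u∈ (adj-sym uv) e)
      ...   | inj₂ (inj₂ (inj₂ (y , e , d2))) = y , inj₁ e , d2
      approach {u} {v} u∈ v∈ uv | inj₂ d with near d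
      ...   | inj₁ refl = ⊥-elim (absent v∈)
      ...   | inj₂ (inj₁ e) = ⊥-elim (not1 v∈ e)
      ...   | inj₂ (inj₂ (inj₁ e)) = ⊥-elim (not2 u∈ v∈ uv e)
      ...   | inj₂ (inj₂ (inj₂ (y , e , d2))) = y , inj₂ e , d2

      token : ∀ i → Edge i → All (_∈ₗ L) (verts i) → ∃[ y ] Token o i y
      token (single r) _ _ = r , stay
      token (pair u v) uv (u∈ ∷ v∈ ∷ []) with approach u∈ v∈ uv
      ... | y , inj₁ uy , d = y , hop (swap v u refl) (adj-sym uv) uy d
      ... | y , inj₂ vy , d = y , hop refl uv vy d

      token-sep : ∀ {i y} → All (_∈ₗ L) (verts i) → Token o i y → Sep o y
      token-sep (r∈ ∷ []) stay = AtOrigin.sep-origin Q r∈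
      token-sep w (hop p uv vy d) with u∈ ∷ v∈ ∷ [] ← All-resp-↭ (↭-sym p) w =
        AtOrigin.sep-dist2 Q u∈ v∈ uv vy

      tokens : ∀ {is} → All Edge is → All (_∈ₗ L) (flat is) →
        All (λ i → ∃[ y ] (Token o i y × Sep o y)) is
      tokens {[]} _ _ = []
      tokens {i ∷ is} (e ∷ es) w =
        let wi = Allₚ.++⁻ˡ (verts i) w
            y , τ = token i e wi
        in (y , τ , token-sep wi τ) ∷ tokens es (Allₚ.++⁻ʳ (verts i) w)

      -- The middle edge has a token next to one of its ends; reversing the path if necessary makes
      -- that end the third vertex.
      strike-any-path : ∀ {p₁ p₂ p₃ p₄} → All (_∈ₗ L) (p₁ ∷ p₂ ∷ p₃ ∷ p₄ ∷ []) →
        Adj G p₁ p₂ → Adj G p₂ p₃ → Adj G p₃ p₄ → Strike o L 3 (p₁ ∷ p₂ ∷ p₃ ∷ p₄ ∷ [])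
      strike-any-path {p₁} {p₂} {p₃} {p₄} w@(p₁∈ ∷ p₂∈ ∷ p₃∈ ∷ p₄∈ ∷ []) e₁ e₂ e₃
        with approach p₂∈ p₃∈ e₂
      ... | _ , inj₂ vy , d = AtOrigin.strike-path Q w e₁ e₂ e₃ vy d
      ... | _ , inj₁ vy , d = strike-resp-↭ (↭-reverse (p₁ ∷ p₂ ∷ p₃ ∷ p₄ ∷ []))
        (AtOrigin.strike-path Q (p₄∈ ∷ p₃∈ ∷ p₂∈ ∷ p₁∈ ∷ [])
          (adj-sym e₃) (adj-sym e₂) (adj-sym e₁) vy d)

      module _ {a : ℕ} (indep≤ : ∀ {xs} → AllPairs Sep xs → length xs ≤ a) where

        conflict-free : ∀ {is} → Valid L is →
          (∀ {i j rest} → is ↭ i ∷ j ∷ rest → ¬ Strike o L 3 (verts i ++ verts j)) →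
          ∀ {i j rest} → is ↭ i ∷ j ∷ rest →
          ∀ {y z} → Token o i y → Token o j z → Sep y z
        conflict-free V noStrike {i} {j} p {y} {z} τ τ' with valid u w _ ((a₁ ∷ _) ∷ _) ← valid-resp-↭ p V =
          (λ eq → strike (inj₁ eq)) , (λ e → strike (inj₂ e))
          where
          split : verts i ++ verts j ++ _ ≡ (verts i ++ verts j) ++ _
          split = sym (List.++-assoc (verts i) (verts j) _)
          strike : y ≡ z ⊎ Adj G y z → False
          strike c = noStrike p (AtOrigin.conflict Q
            (Allₚ.++⁻ˡ (verts i ++ verts j) (subst (All _) split w)) τ τ' a₁
            (unique-++⁻ˡ (verts i ++ verts j) (subst Unique split u)) c)

        -- Without a strike, the tokens of different items are distinct and nonadjacent. Each is
        -- also separated from `o`, so together with `o` they form an independent set.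
        crowded : ∀ {is} → Valid L is →
          (∀ {i j rest} → is ↭ i ∷ j ∷ rest → ¬ Strike o L 3 (verts i ++ verts j)) →
          suc (length is) ≤ a
        crowded {is} V@(valid _ w e _) noStrike =
          let ys , len , seps , from = choose (tokens e w) (allPairs-by-splitting is λ p (τ , _) (τ' , _) →
                conflict-free V noStrike p τ τ')
          in subst (λ l → suc l ≤ a) len (indep≤ (All.map (λ (_ , _ , _ , s) → s) from ∷ seps))

extract : {A : Set} {xs : List A} (s : List A) → Unique s → All (_∈ₗ xs) s → ∃[ ys ] xs ↭ s ++ ys
extract {xs = xs} [] _ _ = xs , ↭-refl
extract (x ∷ s) (ne ∷ u) (x∈ ∷ s⊆) with ys , p ← ∈⇒↭ x∈
  with zs , q ← extract s u (All.zipWith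
    (λ { (x≢z , z∈) → Any.tail (λ eq → x≢z (sym eq)) (∈-resp-↭ p z∈) }) (ne , s⊆)) =
  zs , ↭-trans p (prep x q)

-- Greedy maximal matchings of the pegs.

module Matchings {n : ℕ} (G : Graph n) where
  open Pegging G
  open Tokens G

  edge : V × V → Item
  edge (u , v) = pair u v

  flatPairs : List (V × V) → List V
  flatPairs ps = flat (map edge ps)

  flatPairs-resp-↭ : ∀ {ps qs} → ps ↭ qs → flatPairs ps ↭ flatPairs qs
  flatPairs-resp-↭ refl = ↭-refl
  flatPairs-resp-↭ (prep e p) = prep _ (prep _ (flatPairs-resp-↭ p))
  flatPairs-resp-↭ (swap e f p) =
    ↭-trans (shifts (verts (edge e)) (verts (edge f)))
      (prep _ (prep _ (prep _ (prep _ (flatPairs-resp-↭ p)))))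
  flatPairs-resp-↭ (trans p q) = ↭-trans (flatPairs-resp-↭ p) (flatPairs-resp-↭ q)

  length-flatPairs : ∀ ps → length (flatPairs ps) ≡ length ps + length ps
  length-flatPairs [] = refl
  length-flatPairs (e ∷ ps) = cong suc (≡.trans (cong suc (length-flatPairs ps)) (sym (ℕ.+-suc _ _)))

  -- The field `loose` is the maximality of the matching. With k pairs and l loose pegs, `size`
  -- reads 2k + l = |L|, and k + l items are available.
  record Matched (L : List V) : Set where
    constructor matched
    field
      pairs   : List (V × V)
      singles : List V
      perm    : flatPairs pairs ++ singles ↭ L
      edges   : All (λ e → Adj G (proj₁ e) (proj₂ e)) pairs
      loose   : AllPairs (λ r s → ¬ Adj G r s) singles

    size : length pairs + length pairs + length singles ≡ length L
    size = ≡.trans (cong (_+ length singles) (sym (length-flatPairs pairs)))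
      (≡.trans (sym (List.length-++ (flatPairs pairs))) (↭-length perm))

    items : List Item
    items = map edge pairs ++ map single singles

    length-items : length items ≡ length pairs + length singles
    length-items = ≡.trans (List.length-++ (map edge pairs))
      (≡.cong₂ _+_ (List.length-map edge pairs) (List.length-map single singles))

    flat-items : flat items ↭ L
    flat-items = ↭-trans (↭-reflexive (flatten pairs)) perm
      where
      flatSingles : ∀ rs → flat (map single rs) ≡ rs
      flatSingles [] = refl
      flatSingles (r ∷ rs) = cong (r ∷_) (flatSingles rs)
      flatten : ∀ ps → flat (map edge ps ++ map single singles) ≡ flatPairs ps ++ singles
      flatten [] = flatSingles singles
      flatten (e ∷ ps) = cong (λ l → proj₁ e ∷ proj₂ e ∷ l) (flatten ps)

    items-valid : Unique L → Valid L items
    items-valid u = valid (unique-resp-↭ (↭-sym flat-items) u)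
      (All.tabulate (∈-resp-↭ flat-items))
      (Allₚ.++⁺ (Allₚ.map⁺ edges) (Allₚ.map⁺ (All.universal (λ _ → tt) singles)))
      (AllPairsₚ.++⁺ (AllPairsₚ.map⁺ (allPairs-by-splitting pairs (λ _ → tt))) (AllPairsₚ.map⁺ loose)
        (Allₚ.map⁺ (All.universal (λ _ → Allₚ.map⁺ (All.universal (λ _ → tt) singles)) pairs)))

  match : ∀ L → Matched L
  match [] = matched [] [] refl [] []
  match (z ∷ L) with matched ps ss p es ls ← match L | Any.any? (adj? z) ss
  ... | no none = matched ps (z ∷ ss) (↭-trans (shift z (flatPairs ps) ss) (prep z p)) es
    (Allₚ.¬Any⇒All¬ ss none ∷ ls)
  ... | yes some with r , r∈ , zr ← find some with ss' , q ← ∈⇒↭ r∈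
    with _ ∷ ls' ← allPairs-resp-↭ (λ na e → na (adj-sym e)) q ls =
    matched ((z , r) ∷ ps) ss'
      (prep z (↭-trans (↭-sym (shift r (flatPairs ps) ss')) (↭-trans (++⁺ˡ (flatPairs ps) (↭-sym q)) p)))
      (zr ∷ es) ls'

-- The upper bound

module Upper {n : ℕ} (G : Graph n) (ve : ∀ x u v → Adj G u v → VEDistLe G x u v 3) where
  open Pegging G
  open Tokens G
  open Matchings G
  open VEBounded ve

  module _ {a : ℕ} (indep≤ : ∀ {xs} → AllPairs Sep xs → length xs ≤ a) {t : V} where

    -- A failure of quietness around the pegged neighbour `x` wins at once: a peg beside `x`, or one
    -- brought there by a single jump, jumps over `x` into `t`.
    quiet-near : ∀ {E x L} → Adj G x t → x ∈ E → x ∉ₗ L → All (_∈ E) L →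
      ¬ ReachableWithin G 4 E t → Quiet x L
    quiet-near {E} {x} {L} xt x∈ x∉ L⊆ far = record
      { absent = x∉
      ; not1 = λ v∈ vx → far (jump (All.lookup L⊆ v∈) x∈ vx xt λ E' t∈ _ → reachableNow t∈)
      ; not2 = λ u∈ v∈ uv (p , vp , px) → far
          (jump (All.lookup L⊆ u∈) (All.lookup L⊆ v∈) uv vp λ E' p∈ keep →
            jump p∈ (keep x∈ (≢x u∈) (≢x v∈)) px xt λ E'' t∈ _ → reachableNow t∈)
      }
      where
      ≢x : ∀ {z} → z ∈ₗ L → z ≢ x
      ≢x z∈ refl = x∉ z∈

    strike-near : ∀ {E x s L R} → Adj G x t → Unique (x ∷ L) → All (_∈ E) (x ∷ L) →
      L ↭ s ++ R → Strike x L 3 s → ReachableWithin G 4 E t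
    strike-near {x = x} {s} {L} {R} xt u E⊆ p (q , qx , f) =
      win-resp-↭ (↭-trans (shift x s R) (prep x (↭-sym p)))
        (f (inj₂ refl ∷ All.map inj₁ R⊆)
          (capture (here refl) (there (here refl)) qx xt)) u _ E⊆
      where
      R⊆ : All (_∈ₗ L) R
      R⊆ = Allₚ.++⁻ʳ s (All-resp-↭ p (All.tabulate (λ z∈ → z∈)))

    -- With `a` items besides `x`, the absence of a strike would give an independent set of size a +
    -- 1 by `crowded`. A strike pegs a neighbour of `x` in three moves, and the fourth jumps over
    -- `x` into `t`.
    stage-two : ∀ {x is} → Adj G x t → Valid (flat is) is → a ≤ length is → Win 4 (x ∷ flat is) t
    stage-two {x} {is} xt V a≤ u@(x≢ ∷ _) E E⊆@(x∈ ∷ is⊆) =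
      decidable-stable (reachableWithin? 4 E t) λ far →
        ℕ.<⇒≱ (crowded (quiet-near xt x∈ (λ x∈is → All.lookup x≢ x∈is refl) is⊆ far) indep≤ V
          λ {i} {j} {rest} p str → far (strike-near xt u E⊆
            (↭-trans (flat-resp-↭ p) (↭-reflexive (sym (List.++-assoc (verts i) (verts j) (flat rest))))) str))
          a≤

    stage-two-path : ∀ {x p₁ p₂ p₃ p₄ R} → Adj G x t → Adj G p₁ p₂ → Adj G p₂ p₃ → Adj G p₃ p₄ →
      Win 4 (x ∷ p₁ ∷ p₂ ∷ p₃ ∷ p₄ ∷ R) t
    stage-two-path {x} xt e₁ e₂ e₃ u@(x≢ ∷ _) E E⊆@(x∈ ∷ L⊆) =
      decidable-stable (reachableWithin? 4 E t) λ far →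
        far (strike-near xt u E⊆ ↭-refl
          (strike-any-path (quiet-near xt x∈ (λ x∈L → All.lookup x≢ x∈L refl) L⊆ far)
            (here refl ∷ there (here refl) ∷ there (there (here refl)) ∷ there (there (there (here refl))) ∷ [])
            e₁ e₂ e₃))

    stage-two-matched : ∀ {x R} (m : Matched R) → Adj G x t →
      a ≤ length (Matched.pairs m) + length (Matched.singles m) → Win 4 (x ∷ R) t
    stage-two-matched {x} {R} m xt a≤ u@(_ ∷ uR) =
      win-resp-↭ (prep x flat-items) (stage-two xt self (subst (a ≤_) (sym length-items) a≤)) u
      where
      open Matched m
      self : Valid (flat items) items
      self with valid u' _ e l ← items-valid uR = valid u' (All.tabulate (λ z∈ → z∈)) e l

    -- A maximal matching of `R` has at least half as many items as `R` has pegs, so 2a - 1 pegs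
    -- already supply `a` items.
    stage-two-half : ∀ {x R} → Adj G x t → a + a ≤ suc (length R) → Win 4 (x ∷ R) t
    stage-two-half {x} {R} xt 2a≤ = stage-two-matched m xt
      (ℕ.≮⇒≥ λ small → ℕ.<⇒≱ (s≤s ℕ.≤-refl) (bound small))
      where
      m : Matched R
      m = match R
      open Matched m
      k l : ℕ
      k = length pairs
      l = length singles
      bound : k + l < a → suc (suc (length R)) ≤ suc (length R)
      bound small = ℕ.≤-trans (begin
        suc (suc (length R))       ≡⟨ cong (λ s → suc (suc s)) (sym size) ⟩
        suc (suc (k + k + l))      ≡⟨ cong (λ s → suc (suc s)) (ℕ.+-assoc k k l) ⟩
        suc (suc (k + (k + l)))    ≤⟨ s≤s (s≤s (ℕ.+-monoˡ-≤ (k + l) (ℕ.m≤m+n k l))) ⟩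
        suc (suc (k + l + (k + l))) ≡⟨ cong suc (sym (ℕ.+-suc (k + l) (k + l))) ⟩
        suc (k + l) + suc (k + l)  ≤⟨ ℕ.+-mono-≤ small small ⟩
        a + a                      ∎) 2a≤
        where open ℕ.≤-Reasoning

    -- Consequences of a failure of 2a + 1 pegs within seven moves.

    module _ {D : Subset n} (far : ¬ ReachableWithin G 7 D t)
             {L : List V} (uL : Unique L) (L⊆D : All (_∈ D) L) (lenL : length L ≡ suc (a + a)) where

      Good : List V → Set
      Good l = Unique l × All (_∈ₗ L) l

      good-resp-↭ : ∀ {l l'} → l ↭ l' → Good l → Good l'
      good-resp-↭ p (u , w) = unique-resp-↭ p u , All-resp-↭ p w

      lose : ∀ {l} → Good l → ¬ Win 7 l t
      lose (u , w) W = far (W u D (All.map (All.lookup L⊆D) w))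

      lose-all : ∀ {l} → L ↭ l → ¬ Win 7 l t
      lose-all p = lose (good-resp-↭ p (uL , All.tabulate (λ z∈ → z∈)))

      no-neighbour : ∀ {v} → v ∈ₗ L → ¬ Adj G v t
      no-neighbour v∈ vt with R , p ← ∈⇒↭ v∈ =
        lose-all p (win-mono (ℕ.m≤m+n 4 3) (stage-two-half vt
          (subst (a + a ≤_) (≡.trans (sym lenL) (↭-length p)) (ℕ.n≤1+n _))))

      quiet : Quiet t L
      quiet = record
        { absent = λ t∈ → far (reachableNow (All.lookup L⊆D t∈))
        ; not1 = no-neighbour
        -- Jumping `u` over `v` onto a neighbour of `t` leaves 2a - 1 other pegs, exactly what
        -- `stage-two-half` requires.
        ; not2 = λ u∈ v∈ uv (x , vx , xt) →
            let R , p = extract (_ ∷ _ ∷ []) ((adj⇒≢ uv ∷ []) ∷ [] ∷ []) (u∈ ∷ v∈ ∷ []) in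
            lose-all p (win-mono (ℕ.m≤m+n 5 2) (play (here refl) (here refl) uv vx
              (All.tabulate λ { z∈ refl → no-neighbour (∈-resp-↭ (↭-sym p) (there (there z∈))) xt })
              (stage-two-half xt (ℕ.≤-reflexive (ℕ.suc-injective (≡.trans (sym lenL) (↭-length p)))))))
        }

      open Quiet quiet
      open AtOrigin quiet

      -- Among a + 2 items two must be in conflict. They peg a neighbour of `t` in three moves, and
      -- the `a` items left over finish in four more.
      few-items : ∀ {is} → Valid L is → length is ≤ suc a
      few-items {is} V = ℕ.≮⇒≥ λ many →
        ℕ.<⇒≱ (crowded quiet indep≤ V λ {i} {j} {rest} p (q , qt , f) →
          lose (good-resp-↭ (↭-trans (flat-resp-↭ p)
                  (↭-reflexive (sym (List.++-assoc (verts i) (verts j) (flat rest)))))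
                  (Valid.unique V , Valid.within V))
            (f (All.map inj₁ (rest⊆ {i} {j} p))
              (stage-two qt (valid-rest {i} {j} p)
                (s≤s⁻¹ (s≤s⁻¹ (subst (suc (suc a) ≤_) (↭-length p) many))))))
          (ℕ.≤-trans (ℕ.n≤1+n _) (ℕ.≤-trans (ℕ.n≤1+n _) many))
        where
        rest⊆ : ∀ {i j rest} → is ↭ i ∷ j ∷ rest → All (_∈ₗ L) (flat rest)
        rest⊆ {i} {j} p =
          Allₚ.++⁻ʳ (verts j) (Allₚ.++⁻ʳ (verts i) (Valid.within (valid-resp-↭ p V)))
        valid-rest : ∀ {i j rest} → is ↭ i ∷ j ∷ rest → Valid (flat rest) rest
        valid-rest {i} {j} p with valid u _ (_ ∷ _ ∷ e) (_ ∷ _ ∷ l) ← valid-resp-↭ p V =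
          valid (unique-++⁻ʳ (verts j) (unique-++⁻ʳ (verts i) u)) (All.tabulate (λ z∈ → z∈)) e l

      all∈ : ∀ {l} → L ↭ l → All (_∈ₗ L) l
      all∈ p = All-resp-↭ p (All.tabulate (λ z∈ → z∈))

      -- Only three pegs are spent on the neighbour q of t, so the other pegs must be perfectly matched,
      -- none of them next to y, and y and t extend the independent set of first endpoints.
      no-three : ∀ {g h c y} → g ∈ₗ L → h ∈ₗ L → c ∈ₗ L → g ≢ c → h ≢ c →
        Adj G g h → Adj G h y → Adj G c y → ¬ Dist2 t y
      no-three {g} {h} {c} {y} g∈ h∈ c∈ g≢c h≢c gh hy cy d@(q , yq , qt)
        with R , p ← extract (g ∷ h ∷ c ∷ []) ((adj⇒≢ gh ∷ g≢c ∷ []) ∷ (h≢c ∷ []) ∷ [] ∷ [])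
                       (g∈ ∷ h∈ ∷ c∈ ∷ []) =
        ℕ.<⇒≱ (s≤s (subst (λ l → a ≤ suc l) (sym (List.length-map proj₁ pairs)) many))
          (indep≤ {t ∷ y ∷ map proj₁ pairs}
            ((sep-dist2 g∈ h∈ gh hy ∷ Allₚ.map⁺ (all-by-splitting pairs t-sep))
              ∷ Allₚ.map⁺ (all-by-splitting pairs y-sep)
              ∷ AllPairsₚ.map⁺ (allPairs-by-splitting pairs pair-sep)))
        where
        m : Matched R
        m = match R
        open Matched m
        k l : ℕ
        k = length pairs
        l = length singles

        after : ∀ {R'} → R ↭ R' → ¬ Win 4 (q ∷ R') t
        after r W with _ ∷ _ ∷ _ ∷ R⊆ ← all∈ (↭-trans p (++⁺ˡ (g ∷ h ∷ c ∷ []) r)) =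
          lose-all (↭-trans p (++⁺ˡ (g ∷ h ∷ c ∷ []) r))
            (win-mono (ℕ.n≤1+n 6) (strike-two g∈ h∈ c∈ gh hy cy d (All.map inj₁ R⊆) W))

        few : k + l < a
        few = ℕ.≰⇒> λ a≤ → after ↭-refl (stage-two-matched m qt a≤)

        -- Here 2k + l = 2a - 2, so k + l < a forces k to be at least a - 1.
        many : a ≤ suc k
        many = ℕ.+-cancelʳ-≤ a a (suc k) (begin
          a + a             ≡⟨ ℕ.suc-injective (≡.trans (sym lenL) (↭-length p)) ⟩
          suc (suc (length R)) ≡⟨ cong (λ s → suc (suc s)) (sym size) ⟩
          suc (suc (k + k + l)) ≡⟨ cong (λ s → suc (suc s)) (ℕ.+-assoc k k l) ⟩
          suc (suc (k + (k + l))) ≡⟨ cong suc (sym (ℕ.+-suc k (k + l))) ⟩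
          suc k + suc (k + l) ≤⟨ ℕ.+-monoʳ-≤ (suc k) few ⟩
          suc k + a ∎)
          where open ℕ.≤-Reasoning

        split : ∀ {ps} → pairs ↭ ps → R ↭ flatPairs ps ++ singles
        split r = ↭-trans (↭-sym perm) (++⁺ʳ singles (flatPairs-resp-↭ r))

        t-sep : ∀ {e ps} → pairs ↭ e ∷ ps → Sep t (proj₁ e)
        t-sep r with _ ∷ _ ∷ _ ∷ e∈ ∷ _ ← all∈ (↭-trans p (++⁺ˡ (g ∷ h ∷ c ∷ []) (split r))) =
          sep-origin e∈

        y-sep : ∀ {e ps} → pairs ↭ e ∷ ps → Sep y (proj₁ e)
        y-sep {e₁ , e₂} {ps} r
          with _ ∷ _ ∷ _ ∷ e∈ ∷ _ ∷ R⊆ ← all∈ (↭-trans p (++⁺ˡ (g ∷ h ∷ c ∷ []) (split r)))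
             | adj ∷ _ ← All-resp-↭ r edges =
          -- If `e₁` were next to `y`, then `e₂` could jump over `e₁` into `y` and from there over
          -- the peg on `q` into `t`.
          ∉⇒≢ y∉ e∈ , λ ye → after (↭-trans (split r) (swap e₁ e₂ ↭-refl))
            (win-mono (ℕ.m≤m+n 2 2)
              (play (there (here refl)) (there (here refl)) (adj-sym adj) (adj-sym ye)
                (adj⇒≢ yq ∷ All.map (∉⇒≢ y∉) R⊆)
                (capture (here refl) (there (here refl)) yq qt)))
          where
          y∉ : y ∉ₗ L
          y∉ = dist2-fresh h∈ hy d

        pair-sep : ∀ {e f ps} → pairs ↭ e ∷ f ∷ ps → Sep (proj₁ e) (proj₁ f)
        pair-sep {e₁ , e₂} {f₁ , f₂} {ps} r
          with _ ∷ _ ∷ _ ∷ (_ ∷ ne ∷ _) ∷ _ ← unique-resp-↭ (↭-trans p (++⁺ˡ (g ∷ h ∷ c ∷ []) (split r))) uL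
             | ee ∷ ff ∷ _ ← All-resp-↭ r edges =
          ne , λ ef → after (↭-trans (split r) (swap e₁ e₂ ↭-refl)) (stage-two-path qt (adj-sym ee) ef ff)

      Private : V → V → Set
      Private w y = ∀ {c} → c ∈ₗ L → Adj G c y → c ≡ w

      -- Another pegged neighbour `c` of `y` contradicts `no-three`: the peg that jumps over `w` is
      -- `u` or `v`, whichever differs from `c`.
      private-middle : ∀ {u w v y} → u ∈ₗ L → w ∈ₗ L → v ∈ₗ L → u ≢ v →
        Adj G u w → Adj G w v → Adj G w y → Dist2 t y → Private w y
      private-middle {u} {w} {v} u∈ w∈ v∈ u≢v uw wv wy d {c} c∈ cy with c Fin.≟ w | u Fin.≟ c
      ... | yes c≡w | _ = c≡w
      ... | no c≢w | no u≢c = ⊥-elim (no-three u∈ w∈ c∈ u≢c (λ eq → c≢w (sym eq)) uw wy cy d)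
      ... | no c≢w | yes refl =
        ⊥-elim (no-three v∈ w∈ c∈ (λ eq → u≢v (sym eq)) (λ eq → c≢w (sym eq)) (adj-sym wv) wy cy d)

      -- If the intruder `c` is not `u`, then `u` jumps over `w`; if it is `u`, then `v` jumps over
      -- `u` and `w` serves as the third peg. Both contradict `no-three`.
      private-end : ∀ {w u v y} → w ∈ₗ L → u ∈ₗ L → v ∈ₗ L → w ≢ v →
        Adj G w u → Adj G u v → Adj G w y → Dist2 t y → Private w y
      private-end {w} {u} {v} w∈ u∈ v∈ w≢v wu uv wy d {c} c∈ cy with c Fin.≟ w | u Fin.≟ c
      ... | yes c≡w | _ = c≡w
      ... | no c≢w | no u≢c = ⊥-elim (no-three u∈ w∈ c∈ u≢c (λ eq → c≢w (sym eq)) (adj-sym wu) wy cy d)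
      ... | no c≢w | yes refl =
        ⊥-elim (no-three v∈ c∈ w∈ (λ eq → w≢v (sym eq)) c≢w (adj-sym uv) cy wy d)

      -- A hop of `u` over `w` whose landing vertex sees no listed peg but `w`. Hence `y` can be
      -- added to any independent set of pegs that avoids `w`.
      record Leg (u w y : V) : Set where
        constructor leg
        field
          {u∈}    : u ∈ₗ L
          {w∈}    : w ∈ₗ L
          uw      : Adj G u w
          wy      : Adj G w y
          dist2   : Dist2 t y
          private-nbr : Private w y

        y∉ : y ∉ₗ L
        y∉ = dist2-fresh w∈ wy dist2

        t-sep : Sep t y
        t-sep = sep-dist2 u∈ w∈ uw wy

        sep : ∀ {z} → z ∈ₗ L → w ≢ z → Sep y z
        sep z∈ w≢z = ∉⇒≢ y∉ z∈ , λ yz → w≢z (sym (private-nbr z∈ (adj-sym yz)))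

        seps : ∀ {I} → All (_∈ₗ L) I → All (w ≢_) I → All (Sep y) I
        seps I⊆ w≢ = All.zipWith (λ (z∈ , w≢z) → sep z∈ w≢z) (I⊆ , w≢)

      -- Adding `t` and `y` to `I` gives a larger independent set, which bounds `length I` by a - 2.
      lone : ∀ {u w y I} → Leg u w y → AllPairs Sep I → All (_∈ₗ L) I → All (w ≢_) I →
        ¬ a ≤ suc (length I)
      lone ℓ ind I⊆ w≢ a≤ = ℕ.<⇒≱ (s≤s a≤)
        (indep≤ ((Leg.t-sep ℓ ∷ All.map sep-origin I⊆) ∷ Leg.seps ℓ I⊆ w≢ ∷ ind))

      -- Were `y` and `y'` nonadjacent, they could be added to `I` together with `t`, giving more
      -- than `a` independent vertices. They differ because each has its own private pegged
      -- neighbour.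
      linked : ∀ {u w y u' w' y' I} → Leg u w y → Leg u' w' y' → w ≢ w' →
        AllPairs Sep I → All (_∈ₗ L) I → All (w ≢_) I → All (w' ≢_) I →
        a ≤ suc (suc (length I)) → Adj G y y'
      linked {y = y} {y' = y'} ℓ ℓ' w≢w' ind I⊆ w≢ w'≢ a≤ = decidable-stable (adj? y y') λ na →
        ℕ.<⇒≱ (s≤s a≤) (indep≤ ((Leg.t-sep ℓ ∷ Leg.t-sep ℓ' ∷ All.map sep-origin I⊆)
          ∷ ((distinct , na) ∷ Leg.seps ℓ I⊆ w≢) ∷ Leg.seps ℓ' I⊆ w'≢ ∷ ind))
        where
        distinct : y ≢ y'
        distinct refl = w≢w' (Leg.private-nbr ℓ' (Leg.w∈ ℓ) (Leg.wy ℓ))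

      avoid : ∀ {y l} → y ∉ₗ L → All (_∈ₗ L) l → All (y ≢_) l
      avoid y∉ = All.map (∉⇒≢ y∉)

      -- With the y's pairwise adjacent, y₁ over y₂ reaches the neighbour x of t,
      -- and y₄ over y₃ then refills y₂.
      four-legs : ∀ {u₁ w₁ y₁ u₂ w₂ y₂ u₃ w₃ y₃ u₄ w₄ y₄ R} →
        Good (u₂ ∷ w₂ ∷ u₁ ∷ w₁ ∷ u₃ ∷ w₃ ∷ u₄ ∷ w₄ ∷ R) →
        Leg u₁ w₁ y₁ → Leg u₂ w₂ y₂ → Leg u₃ w₃ y₃ → Leg u₄ w₄ y₄ →
        Adj G y₁ y₂ → Adj G y₃ y₂ → ¬ Adj G y₄ y₃
      four-legs good@(_ , _ ∷ _ ∷ m₁@(_ ∷ _ ∷ m₃@(_ ∷ _ ∷ m₄@(_ ∷ _ ∷ R⊆)))) ℓ₁ ℓ₂ ℓ₃ ℓ₄ y₁y₂ y₃y₂ y₄y₃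
        with x , y₂x , xt ← Leg.dist2 ℓ₂ =
        let x∉ = λ x∈ → not1 x∈ xt in
        lose good
          (play (here refl) (here refl) (Leg.uw ℓ₂) (Leg.wy ℓ₂) (avoid (Leg.y∉ ℓ₂) m₁)
          (play (there (here refl)) (there (here refl)) (Leg.uw ℓ₁) (Leg.wy ℓ₁)
            (adj⇒≢ y₁y₂ ∷ avoid (Leg.y∉ ℓ₁) m₃)
          (play (here refl) (here refl) y₁y₂ y₂x (avoid x∉ m₃)
          (play (there (here refl)) (there (here refl)) (Leg.uw ℓ₃) (Leg.wy ℓ₃)
            (≢x xt ℓ₃ ∷ avoid (Leg.y∉ ℓ₃) m₄)
          (play (there (there (here refl))) (there (there (here refl))) (Leg.uw ℓ₄) (Leg.wy ℓ₄)
            (adj⇒≢ y₄y₃ ∷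
             ≢x xt ℓ₄ ∷ avoid (Leg.y∉ ℓ₄) R⊆)
          (play (here refl) (here refl) y₄y₃ y₃y₂ (adj⇒≢ y₂x ∷ avoid (Leg.y∉ ℓ₂) R⊆)
          (capture (here refl) (there (here refl)) y₂x xt)))))))
        where
        ≢x : ∀ {u w y x} → Adj G x t → Leg u w y → y ≢ x
        ≢x xt ℓ refl = proj₂ (Leg.t-sep ℓ) (adj-sym xt)

      -- A pegged path oriented so that its third vertex `v` carries the token `y`, along with
      -- further distinct pegs `R`.
      record Path (R : List V) : Set where
        constructor path
        field
          {p₁ p₂ v p₄ y} : V
          good  : Good (p₁ ∷ p₂ ∷ v ∷ p₄ ∷ R)
          e₁    : Adj G p₁ p₂
          e₂    : Adj G p₂ v
          e₃    : Adj G v p₄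
          vy    : Adj G v y
          dist2 : Dist2 t y

        p₁∈ : p₁ ∈ₗ L
        p₁∈ with x∈ ∷ _ ← proj₂ good = x∈
        p₂∈ : p₂ ∈ₗ L
        p₂∈ with _ ∷ x∈ ∷ _ ← proj₂ good = x∈
        v∈ : v ∈ₗ L
        v∈ with _ ∷ _ ∷ x∈ ∷ _ ← proj₂ good = x∈
        p₄∈ : p₄ ∈ₗ L
        p₄∈ with _ ∷ _ ∷ _ ∷ x∈ ∷ _ ← proj₂ good = x∈
        R⊆ : All (_∈ₗ L) R
        R⊆ with _ ∷ _ ∷ _ ∷ _ ∷ w ← proj₂ good = w
        uR : Unique R
        uR with _ ∷ _ ∷ _ ∷ _ ∷ u ← proj₁ good = u
        v≢R : All (v ≢_) R
        v≢R with _ ∷ _ ∷ (_ ∷ ne) ∷ _ ← proj₁ good = ne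

        v-leg : Leg p₄ v y
        v-leg with _ ∷ (_ ∷ p₂≢p₄ ∷ _) ∷ _ ← proj₁ good =
          leg {u∈ = p₄∈} {v∈} (adj-sym e₃) vy dist2 (private-middle p₂∈ v∈ p₄∈ p₂≢p₄ e₂ e₃ vy dist2)

      path-resp-↭ : ∀ {R R'} → R ↭ R' → Path R → Path R'
      path-resp-↭ p (path good e₁ e₂ e₃ vy d) =
        path (good-resp-↭ (prep _ (prep _ (prep _ (prep _ p)))) good) e₁ e₂ e₃ vy d

      -- The first path pegs a neighbour of `t` in three moves, and the second one finishes in four.
      no-second-path : ∀ {s₁ s₂ s₃ s₄ R} → Path (s₁ ∷ s₂ ∷ s₃ ∷ s₄ ∷ R) →
        Adj G s₁ s₂ → Adj G s₂ s₃ → ¬ Adj G s₃ s₄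
      no-second-path P f₁ f₂ f₃ =
        let x , xt , conv = strike-path (p₁∈ ∷ p₂∈ ∷ v∈ ∷ p₄∈ ∷ []) e₁ e₂ e₃ vy dist2 in
        lose good (conv (All.map inj₁ R⊆) (stage-two-path xt f₁ f₂ f₃))
        where open Path P

      heads : ∀ {P : V → Set} ps → All P (flatPairs ps) → All P (map proj₁ ps)
      heads [] [] = []
      heads (e ∷ ps) (x ∷ _ ∷ xs) = x ∷ heads ps xs

      cross : ∀ {z z' w w' R R'} → Path R → R ↭ z' ∷ z ∷ w ∷ w' ∷ R' →
        Adj G z' z → Adj G w w' → Sep z w
      cross P p zz ww with _ ∷ (ne ∷ _) ∷ _ ← unique-resp-↭ p (Path.uR P) =
        ne , λ zw → no-second-path (path-resp-↭ p P) zz zw ww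

      -- An edge between two pairs would join them into a second path on four vertices; the swaps
      -- place the adjacent endpoints in its middle.
      pairs-far : ∀ S {ps e f rest} → Path (S ++ flatPairs ps) → All (λ e → Adj G (proj₁ e) (proj₂ e)) ps →
        ps ↭ e ∷ f ∷ rest →
        ∀ {z w} → z ∈ₗ verts (edge e) → w ∈ₗ verts (edge f) → Sep z w
      pairs-far S {ps} {e₁ , e₂} {f₁ , f₂} {rest} P es r = go
        where
        p : S ++ flatPairs ps ↭ e₁ ∷ e₂ ∷ f₁ ∷ f₂ ∷ S ++ flatPairs rest
        p = ↭-trans (++⁺ˡ S (flatPairs-resp-↭ r)) (shifts S (e₁ ∷ e₂ ∷ f₁ ∷ f₂ ∷ []))
        ee : Adj G e₁ e₂
        ee = All.head (All-resp-↭ r es)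
        ff : Adj G f₁ f₂
        ff = All.head (All.tail (All-resp-↭ r es))
        go : ∀ {z w} → z ∈ₗ e₁ ∷ e₂ ∷ [] → w ∈ₗ f₁ ∷ f₂ ∷ [] → Sep z w
        go (here refl) (here refl) = cross P (↭-trans p (swap e₁ e₂ ↭-refl)) (adj-sym ee) ff
        go (here refl) (there (here refl)) =
          cross P (↭-trans p (swap e₁ e₂ (swap f₁ f₂ ↭-refl))) (adj-sym ee) (adj-sym ff)
        go (there (here refl)) (here refl) = cross P p ee ff
        go (there (here refl)) (there (here refl)) =
          cross P (↭-trans p (prep e₁ (prep e₂ (swap f₁ f₂ ↭-refl)))) ee (adj-sym ff)

      record Triangle (s₁ s₂ s₃ : V) : Set where
        constructor triangle
        field
          e₁₂ : Adj G s₁ s₂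
          e₂₃ : Adj G s₂ s₃
          e₁₃ : Adj G s₁ s₃

      -- A triangle can be traversed so as to end at any of its vertices, so an edge leaving it
      -- towards `z` would complete a second path.
      triangle-far : ∀ {s₁ s₂ s₃ z R} → Path (s₁ ∷ s₂ ∷ s₃ ∷ R) → Triangle s₁ s₂ s₃ → z ∈ₗ R →
        Sep s₁ z × Sep s₂ z × Sep s₃ z
      triangle-far {s₁} {s₂} {s₃} {z} P (triangle e₁₂ e₂₃ e₁₃) z∈
        with R , p ← ∈⇒↭ z∈ with P' ← path-resp-↭ (prep s₁ (prep s₂ (prep s₃ p))) P
        with (_ ∷ _ ∷ n₁ ∷ _) ∷ (_ ∷ n₂ ∷ _) ∷ (n₃ ∷ _) ∷ _ ← Path.uR P' =
        (n₁ , no-second-path (path-resp-↭ (↭-sym (++⁺ʳ _ (↭-reverse (s₁ ∷ s₂ ∷ s₃ ∷ [])))) P')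
          (adj-sym e₂₃) (adj-sym e₁₂)) ,
        (n₂ , no-second-path (path-resp-↭ (prep s₁ (swap s₂ s₃ ↭-refl)) P') e₁₃ (adj-sym e₂₃)) ,
        (n₃ , no-second-path P' e₁₂ e₂₃)

      -- A pegged path, a pegged triangle and disjoint pegged edges.

      module PathAndTriangle {s₁ s₂ s₃ : V} {ks : List (V × V)} (P : Path (s₁ ∷ s₂ ∷ s₃ ∷ flatPairs ks))
          (T : Triangle s₁ s₂ s₃) (es : All (λ e → Adj G (proj₁ e) (proj₂ e)) ks)
          {yₛ : V} (sy : Adj G s₁ yₛ) (dₛ : Dist2 t yₛ) (a≤ : a ≤ suc (suc (suc (length ks)))) where
        open Path P
        open Triangle T

        s-leg : Leg s₂ s₁ yₛ
        s-leg with (s₁∈ ∷ s₂∈ ∷ s₃∈ ∷ _) ← R⊆ | _ ∷ (s₂≢s₃ ∷ _) ∷ _ ← uR =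
          leg {u∈ = s₂∈} {s₁∈} (adj-sym e₁₂) sy dₛ
            (private-middle s₂∈ s₁∈ s₃∈ s₂≢s₃ (adj-sym e₁₂) e₁₃ sy dₛ)

        s-far : ∀ {z} → z ∈ₗ flatPairs ks → Sep s₁ z × Sep s₂ z × Sep s₃ z
        s-far = triangle-far P T

        ks-indep : AllPairs Sep (map proj₁ ks)
        ks-indep = AllPairsₚ.map⁺ (allPairs-by-splitting ks λ r →
          pairs-far (s₁ ∷ s₂ ∷ s₃ ∷ []) P es r (here refl) (here refl))

        first-leg : ∃[ u ] ∃[ w ] ∃[ z ] (u ∷ w ∷ [] ↭ p₁ ∷ p₂ ∷ [] × Leg u w z)
        first-leg with approach quiet p₁∈ p₂∈ e₁ | proj₁ good
        ... | z , inj₁ p₁z , d | (_ ∷ p₁≢v ∷ _) ∷ _ = p₂ , p₁ , z , swap p₂ p₁ refl ,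
          leg {u∈ = p₂∈} {p₁∈} (adj-sym e₁) p₁z d (private-end p₁∈ p₂∈ v∈ p₁≢v e₁ e₂ p₁z d)
        ... | z , inj₂ p₂z , d | (_ ∷ p₁≢v ∷ _) ∷ _ = p₁ , p₂ , z , refl ,
          leg {u∈ = p₁∈} {p₂∈} e₁ p₂z d (private-middle p₁∈ p₂∈ v∈ p₁≢v e₁ e₂ p₂z d)

        module _ {h h° : V} {rest : List (V × V)} (r : ks ↭ (h , h°) ∷ rest) where

          whole : p₁ ∷ p₂ ∷ v ∷ p₄ ∷ s₁ ∷ s₂ ∷ s₃ ∷ flatPairs ks ↭
                  p₁ ∷ p₂ ∷ v ∷ p₄ ∷ s₁ ∷ s₂ ∷ s₃ ∷ h ∷ h° ∷ flatPairs rest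
          whole = ++⁺ˡ (p₁ ∷ p₂ ∷ v ∷ p₄ ∷ s₁ ∷ s₂ ∷ s₃ ∷ []) (flatPairs-resp-↭ r)

          hh° : Adj G h h°
          hh° = All.head (All-resp-↭ r es)

          -- The pegs `p`, `h`, `h°` form a path, so the landing vertex of the hop is private
          -- whether the hop goes over its middle `h` or its end `h°`.
          attached-leg : ∀ {p} → p ∈ₗ p₁ ∷ p₂ ∷ v ∷ p₄ ∷ [] → Adj G p h →
            ∃[ u ] ∃[ w ] ∃[ z ] (u ∷ w ∷ [] ↭ h ∷ h° ∷ [] × Leg u w z)
          attached-leg {p} i ph
            with u₁ , w₁ ← good-resp-↭ whole good
            with h∈ ∷ h°∈ ∷ _ ← Allₚ.++⁻ʳ (p₁ ∷ p₂ ∷ v ∷ p₄ ∷ s₁ ∷ s₂ ∷ s₃ ∷ []) w₁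
               | p∈ ← All.lookup w₁ (∈-++⁺ˡ {ys = s₁ ∷ s₂ ∷ s₃ ∷ h ∷ h° ∷ flatPairs rest} i)
               | p≢h° ← unique-++-≢ (p₁ ∷ p₂ ∷ v ∷ p₄ ∷ []) u₁ i (there (there (there (there (here refl)))))
            with approach quiet h∈ h°∈ hh°
          ... | z , inj₁ hz , d = h° , h , z , swap h° h refl ,
            leg {u∈ = h°∈} {h∈} (adj-sym hh°) hz d
              (private-middle h°∈ h∈ p∈ (λ eq → p≢h° (sym eq)) (adj-sym hh°) (adj-sym ph) hz d)
          ... | z , inj₂ h°z , d = h , h° , z , refl ,
            leg {u∈ = h∈} {h°∈} hh° h°z d
              (private-end h°∈ h∈ p∈ (λ eq → p≢h° (sym eq)) (adj-sym hh°) (adj-sym ph) h°z d)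

          -- An attached edge would supply a fourth leg beside those of `p₁p₂`, of `v` and of the
          -- triangle. A common independent set links their landing vertices by `linked`, which
          -- `four-legs` excludes.
          not-attached : ∀ {p} → p ∈ₗ p₁ ∷ p₂ ∷ v ∷ p₄ ∷ [] → ¬ Adj G p h
          not-attached {p} i ph
            with u₁ , w₁ , y₁ , perm₁ , ℓ₁ ← first-leg
               | u₄ , w₄ , y₄ , perm₄ , ℓ₄ ← attached-leg i ph =
            four-legs (good-resp-↭ reorder all-good) ℓ₁ v-leg s-leg ℓ₄
              (link ℓ₁ v-leg (unique-++-≢ (u₁ ∷ w₁ ∷ []) u (there (here refl)) (here refl))
                (avoids (there (here refl))) (avoids (there (there (here refl)))))
              (link s-leg v-leg (λ eq → unique-++-≢ (u₁ ∷ w₁ ∷ v ∷ []) u (there (there (here refl)))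
                (there (here refl)) (sym eq)) s-avoids (avoids (there (there (here refl)))))
              (link ℓ₄ s-leg (λ eq → unique-++-≢ (u₁ ∷ w₁ ∷ v ∷ p₄ ∷ s₁ ∷ []) u
                (there (there (there (there (here refl))))) (there (there (there (here refl)))) (sym eq))
                w₄-avoids s-avoids)
            where
            all-good : Good (u₁ ∷ w₁ ∷ v ∷ p₄ ∷ s₁ ∷ s₂ ∷ s₃ ∷ u₄ ∷ w₄ ∷ flatPairs rest)
            all-good = good-resp-↭ (↭-trans whole (↭-trans
              (++⁺ʳ (v ∷ p₄ ∷ s₁ ∷ s₂ ∷ s₃ ∷ h ∷ h° ∷ flatPairs rest) (↭-sym perm₁))
              (++⁺ˡ (u₁ ∷ w₁ ∷ v ∷ p₄ ∷ s₁ ∷ s₂ ∷ s₃ ∷ []) (++⁺ʳ (flatPairs rest) (↭-sym perm₄))))) good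
            u = proj₁ all-good
            reorder : u₁ ∷ w₁ ∷ v ∷ p₄ ∷ s₁ ∷ s₂ ∷ s₃ ∷ u₄ ∷ w₄ ∷ flatPairs rest ↭
                      p₄ ∷ v ∷ u₁ ∷ w₁ ∷ s₂ ∷ s₁ ∷ u₄ ∷ w₄ ∷ s₃ ∷ flatPairs rest
            reorder = ↭-trans (shifts (u₁ ∷ w₁ ∷ []) (v ∷ p₄ ∷ []))
              (swap v p₄ (prep u₁ (prep w₁ (swap s₁ s₂
                (↭-sym (shift s₃ (u₄ ∷ w₄ ∷ []) (flatPairs rest)))))))
            -- One peg from the triangle, one from the attached edge and one from each remaining
            -- edge, none of them jumped over by the four legs. This set has |ks| + 1 elements, just
            -- enough for `linked`.
            I : List V
            I = s₂ ∷ u₄ ∷ map proj₁ rest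
            rest⊆ks : ∀ {z} → z ∈ₗ u₄ ∷ w₄ ∷ flatPairs rest → z ∈ₗ flatPairs ks
            rest⊆ks z∈ = ∈-resp-↭ (↭-trans (++⁺ʳ (flatPairs rest) perm₄) (↭-sym (flatPairs-resp-↭ r))) z∈
            rest-heads : All (_∈ₗ flatPairs rest) (map proj₁ rest)
            rest-heads = heads rest (All.tabulate (λ z∈ → z∈))
            I⊆ : All (_∈ₗ L) I
            I⊆ with _ ∷ _ ∷ _ ∷ _ ∷ _ ∷ s₂∈ ∷ _ ∷ u₄∈ ∷ _ ∷ w ← proj₂ all-good = s₂∈ ∷ u₄∈ ∷ heads rest w
            I-indep : AllPairs Sep I
            I-indep =
              (proj₁ (proj₂ (s-far (rest⊆ks (here refl)))) ∷
                All.map (λ z∈ → proj₁ (proj₂ (s-far (rest⊆ks (there (there z∈)))))) rest-heads)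
              ∷ Allₚ.map⁺ (all-by-splitting rest λ r' →
                  pairs-far (s₁ ∷ s₂ ∷ s₃ ∷ []) P es (↭-trans r (prep _ r'))
                    (∈-resp-↭ perm₄ (here refl)) (here refl))
              ∷ AllPairsₚ.map⁺ (allPairs-by-splitting rest λ r' →
                  pairs-far (s₁ ∷ s₂ ∷ s₃ ∷ []) P es (↭-trans r (↭-trans (prep _ r')
                    (↭-trans (swap _ _ ↭-refl) (prep _ (swap _ _ ↭-refl))))) (here refl) (here refl))
            avoids : ∀ {w} → w ∈ₗ u₁ ∷ w₁ ∷ v ∷ p₄ ∷ [] → All (w ≢_) I
            avoids w∈ =
              beyond w∈ (there (here refl)) ∷ beyond w∈ (there (there (there (here refl)))) ∷
              All.map (λ z∈ → beyond w∈ (there (there (there (there (there z∈)))))) rest-heads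
              where
              beyond : ∀ {w z} → w ∈ₗ u₁ ∷ w₁ ∷ v ∷ p₄ ∷ [] →
                z ∈ₗ s₁ ∷ s₂ ∷ s₃ ∷ u₄ ∷ w₄ ∷ flatPairs rest → w ≢ z
              beyond = unique-++-≢ (u₁ ∷ w₁ ∷ v ∷ p₄ ∷ []) u
            s-avoids : All (s₁ ≢_) I
            s-avoids =
              beyond (here refl) ∷ beyond (there (there (here refl))) ∷
              All.map (λ z∈ → beyond (there (there (there (there z∈))))) rest-heads
              where
              beyond : ∀ {z} → z ∈ₗ s₂ ∷ s₃ ∷ u₄ ∷ w₄ ∷ flatPairs rest → s₁ ≢ z
              beyond = unique-++-≢ (u₁ ∷ w₁ ∷ v ∷ p₄ ∷ s₁ ∷ []) u (there (there (there (there (here refl)))))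
            w₄-avoids : All (w₄ ≢_) I
            w₄-avoids with _ ∷ _ ∷ _ ∷ _ ∷ _ ∷ (_ ∷ _ ∷ s₂≢w₄ ∷ _) ∷ _ ∷ (u₄≢w₄ ∷ _) ∷ w₄≢ ∷ _ ← u =
              (λ eq → s₂≢w₄ (sym eq)) ∷ (λ eq → u₄≢w₄ (sym eq)) ∷ heads rest w₄≢
            link : ∀ {u w y u' w' y'} → Leg u w y → Leg u' w' y' → w ≢ w' →
              All (w ≢_) I → All (w' ≢_) I → Adj G y y'
            link ℓ ℓ' ne w≢ w'≢ = linked ℓ ℓ' ne I-indep I⊆ w≢ w'≢
              (subst (a ≤_) (cong (λ l → suc (suc (suc l)))
                (≡.trans (↭-length r) (cong suc (sym (List.length-map proj₁ rest))))) a≤)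

        ks⊆L : All (_∈ₗ L) (map proj₁ ks)
        ks⊆L with _ ∷ _ ∷ _ ∷ w ← R⊆ = heads ks w

        ks-heads : All (_∈ₗ flatPairs ks) (map proj₁ ks)
        ks-heads = heads ks (All.tabulate (λ z∈ → z∈))

        beyond-path : ∀ {p z} → p ∈ₗ p₁ ∷ p₂ ∷ v ∷ p₄ ∷ [] → z ∈ₗ s₁ ∷ s₂ ∷ s₃ ∷ flatPairs ks → p ≢ z
        beyond-path = unique-++-≢ (p₁ ∷ p₂ ∷ v ∷ p₄ ∷ []) (proj₁ good)

        path-far : ∀ {p} → p ∈ₗ p₁ ∷ p₂ ∷ v ∷ p₄ ∷ [] → All (Sep p) (map proj₁ ks)
        path-far p∈ = All.zipWith (λ (z∈ , na) → beyond-path p∈ (there (there (there z∈))) , na)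
          (ks-heads , Allₚ.map⁺ (all-by-splitting ks λ r → not-attached r p∈))

        length-ks : length (map proj₁ ks) ≡ length ks
        length-ks = List.length-map proj₁ ks

        -- If `p` and `s` were nonadjacent, then with one endpoint of each edge in `ks` they would
        -- be |ks| + 2 independent pegs avoiding `w`, against `lone`.
        touching : ∀ {p s u w y} → p ∈ₗ p₁ ∷ p₂ ∷ v ∷ p₄ ∷ [] → s ∈ₗ s₁ ∷ s₂ ∷ s₃ ∷ [] → Leg u w y →
          w ≢ p → w ≢ s → All (w ≢_) (map proj₁ ks) → Adj G p s
        touching {p} {s} p∈ s∈ ℓ w≢p w≢s w≢ks = decidable-stable (adj? p s) λ na →
          lone ℓ (((beyond-path p∈ (∈-++⁺ˡ s∈) , na) ∷ path-far p∈) ∷ All.map (s-sep s∈) ks-heads ∷ ks-indep)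
            (All.lookup (proj₂ good) (∈-++⁺ˡ p∈) ∷ All.lookup R⊆ (∈-++⁺ˡ s∈) ∷ ks⊆L)
            (w≢p ∷ w≢s ∷ w≢ks)
            (subst (λ l → a ≤ suc (suc (suc l))) (sym length-ks) a≤)
          where
          s-sep : ∀ {s z} → s ∈ₗ s₁ ∷ s₂ ∷ s₃ ∷ [] → z ∈ₗ flatPairs ks → Sep s z
          s-sep (here refl) z∈ = proj₁ (s-far z∈)
          s-sep (there (here refl)) z∈ = proj₁ (proj₂ (s-far z∈))
          s-sep (there (there (here refl))) z∈ = proj₂ (proj₂ (s-far z∈))

        v≢ks : All (v ≢_) (map proj₁ ks)
        v≢ks = All.map (λ z∈ → beyond-path (there (there (here refl))) (there (there (there z∈)))) ks-heads

        contradiction-with-triangle : False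
        contradiction-with-triangle
          with u ← proj₁ good
          with (_ ∷ p₁≢v ∷ _) ∷ (p₂≢v ∷ _) ∷ (v≢p₄ ∷ v≢s₁ ∷ v≢s₂ ∷ v≢s₃ ∷ v≢R) ∷ _ ∷
               (s₁≢s₂ ∷ _ ∷ s₁≢ks) ∷ _ ← u
             | p₁∈ ∷ p₂∈ ∷ v∈ ∷ p₄∈ ∷ s₁∈ ∷ s₂∈ ∷ s₃∈ ∷ ks⊆ ← proj₂ good
             | x , yx , xt ← dist2 =
          let
            sep₂ = All.map (λ z∈ → proj₁ (proj₂ (s-far z∈))) ks-heads
            y∉ = Leg.y∉ v-leg
            p₁s₁ = touching (here refl) (here refl) v-leg (λ eq → p₁≢v (sym eq)) v≢s₁ v≢ks
            p₂s₃ = touching (there (here refl)) (there (there (here refl))) v-leg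
                     (λ eq → p₂≢v (sym eq)) v≢s₃ v≢ks
            vs₂ = touching (there (there (here refl))) (there (here refl)) s-leg
                    (λ eq → v≢s₁ (sym eq)) s₁≢s₂ (heads ks s₁≢ks)
            yₛy = linked s-leg v-leg (λ eq → v≢s₁ (sym eq)) (sep₂ ∷ ks-indep) (s₂∈ ∷ ks⊆L)
                    (s₁≢s₂ ∷ heads ks s₁≢ks) (v≢s₂ ∷ v≢ks)
                    (subst (λ l → a ≤ suc (suc (suc l))) (sym length-ks) a≤)
          in
          -- The six moves: `p₁` over `s₁` into `yₛ`, `s₂` over `v` into `y`, `yₛ` over `y` into
          -- `x`; then `s₃` over `p₂` refills `v`, `p₄` over `v` refills `y`, and `y` jumps over `x`
          -- into `t`.
          lose good (win-mono (ℕ.n≤1+n 6)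
            (play (here refl) (there (there (there (here refl)))) p₁s₁ sy
              (avoid (Leg.y∉ s-leg) (p₂∈ ∷ v∈ ∷ p₄∈ ∷ s₂∈ ∷ s₃∈ ∷ ks⊆))
            (play (there (there (there (there (here refl))))) (there (there (here refl))) (adj-sym vs₂) vy
              ((λ eq → adj⇒≢ yₛy (sym eq)) ∷ avoid y∉ (p₂∈ ∷ p₄∈ ∷ s₃∈ ∷ ks⊆))
            (play (there (here refl)) (here refl) yₛy yx
              (avoid (λ x∈ → not1 x∈ xt) (p₂∈ ∷ p₄∈ ∷ s₃∈ ∷ ks⊆))
            (play (there (there (there (here refl)))) (there (here refl)) (adj-sym p₂s₃) e₂
              ((λ { refl → not1 v∈ xt }) ∷ v≢p₄ ∷ v≢R)
            (play (there (there (here refl))) (here refl) (adj-sym e₃) vy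
              (adj⇒≢ yx ∷ avoid y∉ ks⊆)
            (capture (here refl) (there (here refl)) yx xt)))))))

      -- Choosing an endpoint not adjacent to r from each pair is impossible by independence, so r
      -- forms a triangle with one of the pairs.
      path-and-pairs : ∀ {r hs} → Path (r ∷ flatPairs hs) →
        All (λ e → Adj G (proj₁ e) (proj₂ e)) hs → ¬ a ≤ suc (suc (length hs))
      path-and-pairs {r} {hs} P es a≤ =
        let zs , len , ind , from = choose (all-by-splitting hs detached)
              (allPairs-by-splitting hs λ q (z∈ , _) (w∈ , _) → pairs-far (r ∷ []) P es q z∈ w∈)
        in lone v-leg (All.map (λ (_ , _ , _ , _ , _ , s) → s) from ∷ ind)
          (All.head R⊆ ∷ All.map (λ (_ , _ , _ , z∈ , _) → z∈) from)
          (All.head v≢R ∷ All.map (λ (_ , _ , _ , _ , v≢z , _) → v≢z) from)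
          (subst (λ l → a ≤ suc (suc l)) (sym len) a≤)
        where
        open Path P
        Ok : V → Set
        Ok z = z ∈ₗ L × v ≢ z × Sep r z

        detached : ∀ {e ps} → hs ↭ e ∷ ps → ∃[ z ] (z ∈ₗ verts (edge e) × Ok z)
        detached {e₁ , e₂} {ps} q
          with r∈ ∷ e₁∈ ∷ e₂∈ ∷ _ ← All-resp-↭ (prep r (flatPairs-resp-↭ q)) R⊆
             | _ ∷ v≢e₁ ∷ v≢e₂ ∷ _ ← All-resp-↭ (prep r (flatPairs-resp-↭ q)) v≢R
             | (r≢e₁ ∷ r≢e₂ ∷ _) ∷ _ ← unique-resp-↭ (prep r (flatPairs-resp-↭ q)) uR
             | adj? r e₁ | adj? r e₂
        ... | no na | _ = e₁ , here refl , e₁∈ , v≢e₁ , r≢e₁ , na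
        ... | yes _ | no na = e₂ , there (here refl) , e₂∈ , v≢e₂ , r≢e₂ , na
        ... | yes re₁ | yes re₂ with e₁e₂ ∷ es' ← All-resp-↭ q es
                                | approach quiet e₁∈ e₂∈ (All.head (All-resp-↭ q es))
        -- The endpoint carrying the token becomes the first vertex of the triangle.
        ...   | y , inj₁ e₁y , d = ⊥-elim (PathAndTriangle.contradiction-with-triangle
          (path-resp-↭ (↭-trans (prep r (flatPairs-resp-↭ q))
            (↭-sym (shift r (e₁ ∷ e₂ ∷ []) (flatPairs ps)))) P)
          (triangle e₁e₂ (adj-sym re₂) (adj-sym re₁)) es' e₁y d
          (subst (λ l → a ≤ suc (suc l)) (↭-length q) a≤))
        ...   | y , inj₂ e₂y , d = ⊥-elim (PathAndTriangle.contradiction-with-triangle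
          (path-resp-↭ (↭-trans (prep r (flatPairs-resp-↭ q))
            (↭-trans (↭-sym (shift r (e₁ ∷ e₂ ∷ []) (flatPairs ps))) (swap e₁ e₂ ↭-refl))) P)
          (triangle (adj-sym e₁e₂) (adj-sym re₁) (adj-sym re₂)) es' e₂y d
          (subst (λ l → a ≤ suc (suc l)) (↭-length q) a≤))

      no-path : ∀ {p₁ p₂ p₃ p₄ r hs} → Good (p₁ ∷ p₂ ∷ p₃ ∷ p₄ ∷ r ∷ flatPairs hs) →
        All (λ e → Adj G (proj₁ e) (proj₂ e)) hs → a ≤ suc (suc (length hs)) →
        Adj G p₁ p₂ → Adj G p₂ p₃ → ¬ Adj G p₃ p₄
      no-path {p₁} {p₂} {p₃} {p₄} good@(_ , _ ∷ p₂∈ ∷ p₃∈ ∷ _) es a≤ e₁ e₂ e₃ with approach quiet p₂∈ p₃∈ e₂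
      ... | y , inj₂ p₃y , d = path-and-pairs (path good e₁ e₂ e₃ p₃y d) es a≤
      ... | y , inj₁ p₂y , d = path-and-pairs
        (path (good-resp-↭ (++⁺ʳ _ (↭-sym (↭-reverse (p₁ ∷ p₂ ∷ p₃ ∷ p₄ ∷ [])))) good)
          (adj-sym e₃) (adj-sym e₂) (adj-sym e₁) p₂y d) es a≤

      -- A maximal matching has 2k + l = 2a + 1 and, by `few-items`, k + l at most a + 1; hence k is
      -- at least a. A loose peg exists by parity, so adjacent first endpoints would be excluded by
      -- `no-path`, and these endpoints with `t` form an independent set that is too large.
      absurdity : False
      absurdity = by-singles singles perm odd-split
        where
        open Matched (match L)
        k l : ℕ
        k = length pairs
        l = length singles

        k+[k+l] : k + (k + l) ≡ suc (a + a)
        k+[k+l] = ≡.trans (sym (ℕ.+-assoc k k l)) (≡.trans size lenL)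

        a≤k : a ≤ k
        a≤k = ℕ.+-cancelʳ-≤ (suc a) a k (begin
          a + suc a   ≡⟨ ℕ.+-suc a a ⟩
          suc (a + a) ≡⟨ sym k+[k+l] ⟩
          k + (k + l) ≤⟨ ℕ.+-monoʳ-≤ k (subst (_≤ suc a) length-items (few-items (items-valid uL))) ⟩
          k + suc a   ∎)
          where open ℕ.≤-Reasoning

        -- Without loose pegs 2k would equal the odd number 2a + 1.
        odd-split : l ≢ 0
        odd-split l≡0 = ℕ.<⇒≱ (ℕ.≤-reflexive (≡.trans (sym k+[k+l]) (cong (λ j → k + j)
          (≡.trans (cong (k +_) l≡0) (ℕ.+-identityʳ k))))) (ℕ.+-mono-≤ k≤a k≤a)
          where
          k≤a : k ≤ a
          k≤a = ℕ.≮⇒≥ λ a<k → ℕ.<⇒≱ (ℕ.≤-trans (s≤s (ℕ.≤-reflexive (sym (ℕ.+-suc a a))))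
            (ℕ.+-mono-≤ a<k (ℕ.≤-trans a<k (ℕ.m≤m+n k l)))) (ℕ.≤-reflexive k+[k+l])

        by-singles : ∀ rs → flatPairs pairs ++ rs ↭ L → length rs ≢ 0 → False
        by-singles [] _ odd = odd refl
        by-singles (r ∷ rs) p _ =
          ℕ.<⇒≱ (s≤s a≤k) (subst (λ l → suc l ≤ a) (List.length-map proj₁ pairs)
            (indep≤ {t ∷ map proj₁ pairs}
              (All.map sep-origin (heads pairs (Allₚ.++⁻ˡ (flatPairs pairs) (all∈ (↭-sym p))))
               ∷ AllPairsₚ.map⁺ (allPairs-by-splitting pairs firsts-sep))))
          where
          split : ∀ {ps} → pairs ↭ ps → L ↭ (r ∷ flatPairs ps) ++ rs
          split {ps} q = ↭-trans (↭-sym p) (↭-trans (++⁺ʳ (r ∷ rs) (flatPairs-resp-↭ q))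
            (shift r (flatPairs ps) rs))

          good : ∀ {ps} → pairs ↭ ps → Good (r ∷ flatPairs ps)
          good {ps} q = unique-++⁻ˡ (r ∷ flatPairs ps) (unique-resp-↭ (split q) uL) ,
            Allₚ.++⁻ˡ (r ∷ flatPairs ps) (all∈ (split q))

          firsts-sep : ∀ {e f ps} → pairs ↭ e ∷ f ∷ ps → Sep (proj₁ e) (proj₁ f)
          firsts-sep {e₁ , e₂} {f₁ , f₂} {ps} q
            with g@(_ ∷ (_ ∷ e₁≢f₁ ∷ _) ∷ _ , _) ← good q
               | ee ∷ ff ∷ es ← All-resp-↭ q edges =
            e₁≢f₁ , λ ef → no-path
              (good-resp-↭ (↭-trans (↭-sym (shift r (e₁ ∷ e₂ ∷ f₁ ∷ f₂ ∷ []) (flatPairs ps)))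
              (swap e₁ e₂ ↭-refl)) g) es (subst (a ≤_) (↭-length q) a≤k) (adj-sym ee) ef ff

  upper : ∀ {a} → (∀ S → Independent G S → ∣ S ∣ ≤ a) →
    ∀ D → 2 * a + 1 ≤ ∣ D ∣ → ∀ t → ReachableWithin G 7 D t
  upper {a} α D big t = decidable-stable (reachableWithin? 7 D t) λ far →
    absurdity indep≤ far
      -- Only the first 2a + 1 pegs of `D` are listed; the others are carried along silently by
      -- `Win`.
      (AllPairsₚ.take⁺ (suc (a + a)) (elements-unique D))
      (Allₚ.take⁺ (suc (a + a)) (elements-∈ D))
      (≡.trans (List.length-take (suc (a + a)) (elements D))
        (ℕ.m≤n⇒m⊓n≡m (subst (suc (a + a) ≤_) (sym (length-elements D)) (subst (_≤ ∣ D ∣) count big))))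
    where
    count : 2 * a + 1 ≡ suc (a + a)
    count = ≡.trans (ℕ.+-comm (2 * a) 1) (cong (λ b → suc (a + b)) (ℕ.+-identityʳ a))
    indep≤ : ∀ {xs} → AllPairs Sep xs → length xs ≤ a
    indep≤ {xs} seps = ℕ.≤-trans (length≤∣fromList∣ (AllPairs.map proj₁ seps))
      (α (fromList xs) λ x y x∈ y∈ → nonadjacent (∈-fromList⁻ xs x∈) (∈-fromList⁻ xs y∈) seps)
      where
      nonadjacent : ∀ {x y xs} → x ∈ₗ xs → y ∈ₗ xs → AllPairs Sep xs → ¬ Adj G x y
      nonadjacent (here refl) (here refl) _ = adj-irrefl
      nonadjacent (here refl) (there y∈) (s ∷ _) = proj₂ (All.lookup s y∈)
      nonadjacent (there x∈) (here refl) (s ∷ _) e = proj₂ (All.lookup s x∈) (adj-sym e)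
      nonadjacent (there x∈) (there y∈) (_ ∷ ss) = nonadjacent x∈ y∈ ss

-- Deletions and pigeonhole arguments for the lower bound.

∈-─ : {A : Set} {x z : A} {xs : List A} (i : z ∈ₗ xs) → x ∈ₗ xs → x ≢ z → x ∈ₗ (xs ─ i)
∈-─ (here refl) (here refl) ne = ⊥-elim (ne refl)
∈-─ (here refl) (there x∈) ne = x∈
∈-─ (there i) (here refl) ne = here refl
∈-─ (there i) (there x∈) ne = there (∈-─ i x∈ ne)

length-─ : {A : Set} {z : A} {xs : List A} (i : z ∈ₗ xs) → suc (length (xs ─ i)) ≡ length xs
length-─ (here refl) = refl
length-─ (there i) = cong suc (length-─ i)

no-three-in-pair : {A : Set} {x y w z z' : A} → x ≡ z ⊎ x ≡ z' → y ≡ z ⊎ y ≡ z' → w ≡ z ⊎ w ≡ z' →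
  x ≢ y → x ≢ w → y ≢ w → False
no-three-in-pair (inj₁ refl) (inj₁ refl) _ xy _ _ = xy refl
no-three-in-pair (inj₁ refl) (inj₂ refl) (inj₁ refl) _ xw _ = xw refl
no-three-in-pair (inj₁ refl) (inj₂ refl) (inj₂ refl) _ _ yw = yw refl
no-three-in-pair (inj₂ refl) (inj₂ refl) _ xy _ _ = xy refl
no-three-in-pair (inj₂ refl) (inj₁ refl) (inj₂ refl) _ xw _ = xw refl
no-three-in-pair (inj₂ refl) (inj₁ refl) (inj₁ refl) _ _ yw = yw refl

other : {A : Set} {P : A → Set} {v z z' : A} → P z → P z' → v ≡ z ⊎ v ≡ z' →
  ∃[ r ] (P r × (∀ {x} → x ≢ v → x ≡ z ⊎ x ≡ z' → x ≡ r))
other {z' = z'} pz pz' (inj₁ refl) = z' , pz' , λ { ne (inj₁ eq) → ⊥-elim (ne eq) ; ne (inj₂ eq) → eq }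
other {z = z} pz pz' (inj₂ refl) = z , pz , λ { ne (inj₁ eq) → eq ; ne (inj₂ eq) → ⊥-elim (ne eq) }

does-sound : {P : Set} (p? : Dec P) → does p? ≡ true → P
does-sound (yes p) _ = p

-- The extremal graph

module Cliques {n a : ℕ} (cl : Fin n → Fin a) (tw : Fin n → Fin n) (tw-invol : ∀ x → tw (tw x) ≡ x) where

  -- Each class of `cl` is a clique, and `tw` adds a matching between gates. Fixed points of `tw`
  -- gain no edge, because `x ≢ y` is required.
  Link : Fin n → Fin n → Set
  Link x y = x ≢ y × (cl x ≡ cl y ⊎ x ≡ tw y)

  link? : ∀ x y → Dec (Link x y)
  link? x y = ¬? (x Fin.≟ y) ×-dec (cl x Fin.≟ cl y ⊎-dec x Fin.≟ tw y)

  tw-swap : ∀ {x y} → x ≡ tw y → y ≡ tw x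
  tw-swap {y = y} refl = sym (tw-invol y)

  link-sym : ∀ {x y} → Link x y → Link y x
  link-sym (ne , inj₁ eq) = (λ e → ne (sym e)) , inj₁ (sym eq)
  link-sym (ne , inj₂ eq) = (λ e → ne (sym e)) , inj₂ (tw-swap eq)

  graph : Graph n
  graph = record
    { adj    = λ x y → does (link? x y)
    ; sym    = λ x y → does-⇔ (mk⇔ link-sym link-sym) (link? x y) (link? y x)
    ; irrefl = λ x → dec-false (link? x x) (λ (ne , _) → ne refl)
    }

  adj⇒link : ∀ {x y} → Adj graph x y → Link x y
  adj⇒link {x} {y} = does-sound (link? x y)

  link⇒adj : ∀ {x y} → Link x y → Adj graph x y
  link⇒adj {x} {y} l = dec-true (link? x y) l

  Free : Fin n → Set
  Free x = tw x ≡ x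

  link-free : ∀ {x y} → Free y → Link x y → cl x ≡ cl y
  link-free fr (_ , inj₁ eq) = eq
  link-free fr (ne , inj₂ eq) = ⊥-elim (ne (≡.trans eq fr))

  link-free′ : ∀ {x y} → Free x → Link x y → cl x ≡ cl y
  link-free′ fr l = sym (link-free fr (link-sym l))

  -- The first and last steps of a walk between free vertices stay in their cliques, so changing
  -- cliques needs a step in between.
  free-far : ∀ {x y k} → Free x → Free y → cl x ≢ cl y → DistLe graph x y k → 3 ≤ k
  free-far fx fy ne (_ , j≤k , here) = ⊥-elim (ne refl)
  free-far fx fy ne (_ , j≤k , step e here) = ⊥-elim (ne (link-free fy (adj⇒link e)))
  free-far fx fy ne (_ , j≤k , step e (step f here)) =
    ⊥-elim (ne (≡.trans (link-free′ fx (adj⇒link e)) (link-free fy (adj⇒link f))))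
  free-far fx fy ne (_ , j≤k , step _ (step _ (step _ _))) = ℕ.≤-trans (s≤s (s≤s (s≤s z≤n))) j≤k

  dist-same : ∀ {x y} → cl x ≡ cl y → DistLe graph x y 1
  dist-same {x} {y} eq with x Fin.≟ y
  ... | yes refl = 0 , z≤n , here
  ... | no ne = 1 , s≤s z≤n , step (link⇒adj (ne , inj₁ eq)) here

  walk-++ : ∀ {i j x y z} → Walk graph i x y → Walk graph j y z → Walk graph (i + j) x z
  walk-++ here v = v
  walk-++ (step e w) v = step e (walk-++ w v)

  dist-+ : ∀ {i j x y z} → DistLe graph x y i → DistLe graph y z j → DistLe graph x z (i + j)
  dist-+ (i , i≤ , w) (j , j≤ , v) = i + j , ℕ.+-mono-≤ i≤ j≤ , walk-++ w v

  -- Since every class is a clique, `cl` is injective on an independent set.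
  independent-small : ∀ S → Independent graph S → ∣ S ∣ ≤ a
  independent-small S ind = subst (_≤ a)
    (≡.trans (List.length-map cl (elements S)) (length-elements S))
    (ℕ.≤-trans (length≤∣fromList∣ distinct) (Sub.∣p∣≤n (fromList (map cl (elements S)))))
    where
    distinct : Unique (map cl (elements S))
    distinct = AllPairsₚ.map⁺ (allPairs-by-splitting (elements S) apart)
      where
      apart : ∀ {x y zs} → elements S ↭ x ∷ y ∷ zs → cl x ≢ cl y
      apart p eq with (ne ∷ _) ∷ _ ← unique-resp-↭ p (elements-unique S)
                    | x∈ ∷ y∈ ∷ _ ← All-resp-↭ p (elements-∈ S) =
        ind _ _ x∈ y∈ (link⇒adj (ne , inj₁ eq))

  module Stuck (o : Fin a) (t : Fin n) (t-free : Free t) (cl-t : cl t ≡ o) where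

    -- A cluster in this state cannot emit a peg into another cluster.
    Low : (Fin n → Set) → Fin a → Set
    Low D k = (∃[ q ] (∀ {x} → D x → cl x ≡ k → x ≡ q))
            ⊎ (∃[ z ] ∃[ z' ] (Free z × Free z' × (∀ {x} → D x → cl x ≡ k → x ≡ z ⊎ x ≡ z')))

    low-anti : ∀ {D D' k} → (∀ {x} → D' x → cl x ≡ k → D x) → Low D k → Low D' k
    low-anti sub (inj₁ (q , f)) = inj₁ (q , λ d c → f (sub d c) c)
    low-anti sub (inj₂ (z , z' , fz , fz' , f)) = inj₂ (z , z' , fz , fz' , λ d c → f (sub d c) c)

    -- Of the new distribution only the upper bound `kept` is recorded, as the invariants below
    -- merely limit where pegs can be.
    record Jump (D D' : Fin n → Set) : Set where
      field
        {u v w} : Fin n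
        u∈   : D u
        v∈   : D v
        w∉   : ¬ D w
        uv   : Link u v
        vw   : Link v w
        kept : ∀ {x} → D' x → x ≡ w ⊎ (D x × x ≢ u × x ≢ v)

      shrinks : ∀ {x} → cl x ≢ cl w → D' x → D x
      shrinks ne d with kept d
      ... | inj₁ refl = ⊥-elim (ne refl)
      ... | inj₂ (d' , _) = d'

      -- With a single peg `v`, the jumper comes from outside and is the twin of `v`; leaving the
      -- cluster would mean landing on that occupied twin. With two free pegs, `v` has no outside
      -- neighbour, and both pegs are used up.
      low-jump : Low D (cl v) → cl w ≡ cl v × (∀ {x} → D' x → cl x ≡ cl v → x ≡ w)
      low-jump (inj₁ (q , f)) = inside-w (proj₂ uv) (proj₂ vw) , λ d c → only (kept d) c
        where
        inside-w : cl u ≡ cl v ⊎ u ≡ tw v → cl v ≡ cl w ⊎ v ≡ tw w → cl w ≡ cl v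
        inside-w _ (inj₁ eq) = sym eq
        inside-w (inj₁ eq) _ = ⊥-elim (proj₁ uv (≡.trans (f u∈ eq) (sym (f v∈ refl))))
        inside-w (inj₂ u≡) (inj₂ v≡) = ⊥-elim (w∉ (subst D (≡.trans u≡ (sym (tw-swap v≡))) u∈))
        only : ∀ {x} → x ≡ w ⊎ (D x × x ≢ u × x ≢ v) → cl x ≡ cl v → x ≡ w
        only (inj₁ eq) _ = eq
        only (inj₂ (d , _ , x≢v)) c = ⊥-elim (x≢v (≡.trans (f d c) (sym (f v∈ refl))))
      low-jump (inj₂ (z , z' , fz , fz' , f)) = sym (link-free′ v-free vw) , λ d c → only (kept d) c
        where
        v-free : Free v
        v-free with f v∈ refl
        ... | inj₁ eq = subst Free (sym eq) fz
        ... | inj₂ eq = subst Free (sym eq) fz'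
        only : ∀ {x} → x ≡ w ⊎ (D x × x ≢ u × x ≢ v) → cl x ≡ cl v → x ≡ w
        only (inj₁ eq) _ = eq
        only (inj₂ (d , x≢u , x≢v)) c =
          ⊥-elim (no-three-in-pair (f d c) (f u∈ (link-free v-free uv)) (f v∈ refl) x≢u x≢v (proj₁ uv))

      low-else : Low D (cl v) → ∀ {j} → Low D j → Low D' j
      low-else lv {j} lj with j Fin.≟ cl v
      ... | yes refl = inj₁ (w , proj₂ (low-jump lv))
      ... | no ne = low-anti
        (λ d c → shrinks (λ eq → ne (≡.trans (sym c) (≡.trans eq (proj₁ (low-jump lv))))) d) lj

    Empty : (Fin n → Set) → Set
    Empty D = ∀ {x} → D x → cl x ≢ o

    module _ (s : Fin a) (s≢o : s ≢ o) where

      -- The three phases of play: four free pegs in `s`; one cluster `k` that is low but for an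
      -- extra peg `g`; one peg on a gate `g` of the target cluster, facing a cluster with at most
      -- one peg, which is not a gate.
      data Safe (D : Fin n → Set) : Set where
        reserve : ∀ {ps} → Empty D → length ps ≡ 4 → All Free ps →
          (∀ {x} → D x → cl x ≡ s → x ∈ₗ ps) → (∀ {j} → j ≢ s → Low D j) → Safe D
        surplus : ∀ k g → k ≢ o → Empty D → (∀ {j} → j ≢ k → Low D j) →
          Low (λ x → D x × x ≢ g) k → Safe D
        landed : ∀ g → cl g ≡ o → tw g ≢ g → (∀ {j} → Low D j) →
          (∀ {x} → D x → cl x ≡ o → x ≡ g) →
          (∀ {x} → D x → cl x ≡ cl (tw g) → Free x) →
          (∃[ r ] (∀ {x} → D x → cl x ≡ cl (tw g) → x ≡ r)) → Safe D

      safe-misses : ∀ {D} → Safe D → ¬ D t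
      safe-misses (reserve empty _ _ _ _) d = empty d cl-t
      safe-misses (surplus _ _ _ empty _ _) d = empty d cl-t
      safe-misses (landed g _ gate _ only _ _) d with refl ← only d cl-t = gate t-free

      module _ {D D' : Fin n → Set} (J : Jump D D') where
        open Jump J

        still-empty : Empty D → cl w ≢ o → Empty D'
        still-empty empty w≢o d with kept d
        ... | inj₁ refl = w≢o
        ... | inj₂ (d' , _) = empty d'

        elsewhere : ∀ {j} → j ≢ cl w → Low D j → Low D' j
        elsewhere ne = low-anti λ d c → shrinks (λ eq → ne (≡.trans (sym c) eq)) d

        two : ∀ {ps k} → length ps ≡ 2 → All Free ps → (∀ {x} → D' x × x ≢ w → cl x ≡ k → x ∈ₗ ps) →
          Low (λ x → D' x × x ≢ w) k
        two {z ∷ z' ∷ []} _ (fz ∷ fz' ∷ []) f = inj₂ (z , z' , fz , fz' , λ d c → which (f d c))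
          where
          which : ∀ {x} → x ∈ₗ z ∷ z' ∷ [] → x ≡ z ⊎ x ≡ z'
          which (here eq) = inj₁ eq
          which (there (here eq)) = inj₂ eq

        -- The landing peg `w` becomes the new extra peg. If `v` was the old one, the rest is still
        -- low; otherwise at most one peg remains besides `w`.
        jump-inside : ∀ {g} → cl w ≡ cl v → Low (λ x → D x × x ≢ g) (cl v) → Low (λ x → D' x × x ≢ w) (cl v)
        jump-inside {g} w∈k low with v Fin.≟ g
        ... | yes refl = low-anti (λ (d , x≢w) _ → drop (kept d) x≢w) low
          where
          drop : ∀ {x} → x ≡ w ⊎ (D x × x ≢ u × x ≢ v) → x ≢ w → D x × x ≢ v
          drop (inj₁ eq) x≢w = ⊥-elim (x≢w eq)
          drop (inj₂ (d , _ , x≢v)) _ = d , x≢v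
        jump-inside {g} w∈k (inj₁ (q , f)) | no v≢g = inj₁ (g , λ (d , x≢w) c → only (kept d) x≢w c)
          where
          only : ∀ {x} → x ≡ w ⊎ (D x × x ≢ u × x ≢ v) → x ≢ w → cl x ≡ cl v → x ≡ g
          only (inj₁ eq) x≢w _ = ⊥-elim (x≢w eq)
          only {x} (inj₂ (d , _ , x≢v)) _ c = decidable-stable (x Fin.≟ g) λ x≢g →
            x≢v (≡.trans (f (d , x≢g) c) (sym (f (v∈ , v≢g) refl)))
        jump-inside {g} w∈k (inj₂ (z , z' , fz , fz' , f)) | no v≢g = by (f (v∈ , v≢g) refl) (u Fin.≟ g)
          where
          from-others : ∀ {r} → (∀ {x} → D x → x ≢ u → x ≢ v → cl x ≡ cl v → x ≡ r) →
            Low (λ x → D' x × x ≢ w) (cl v)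
          from-others {r} only = inj₁ (r , λ (d , x≢w) c → go (kept d) x≢w c)
            where
            go : ∀ {x} → x ≡ w ⊎ (D x × x ≢ u × x ≢ v) → x ≢ w → cl x ≡ cl v → x ≡ r
            go (inj₁ eq) x≢w _ = ⊥-elim (x≢w eq)
            go (inj₂ (d , x≢u , x≢v)) _ c = only d x≢u x≢v c

          by : v ≡ z ⊎ v ≡ z' → Dec (u ≡ g) → Low (λ x → D' x × x ≢ w) (cl v)
          by v∈z (yes refl) = let r , _ , is-r = other fz fz' v∈z in
            from-others λ d x≢u x≢v c → is-r x≢v (f (d , x≢u) c)
          by v∈z (no u≢g) = from-others λ {x} d x≢u x≢v c → decidable-stable (x Fin.≟ g) λ x≢g →
            no-three-in-pair (f (d , x≢g) c) (f (u∈ , u≢g) (link-free (v-free v∈z) uv)) v∈z x≢u x≢v (proj₁ uv)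
            where
            v-free : v ≡ z ⊎ v ≡ z' → Free v
            v-free (inj₁ eq) = subst Free (sym eq) fz
            v-free (inj₂ eq) = subst Free (sym eq) fz'

        -- Leaving the cluster goes over a gate `v` to its twin `w`, and `u` must come from inside.
        -- One of `u`, `v` is the extra peg, so the exporting cluster keeps at most one peg, a free
        -- one.
        jump-outside : ∀ {g} → cl w ≢ cl v → Low (λ x → D x × x ≢ g) (cl v) →
          ∃[ r ] (∀ {x} → D' x → cl x ≡ cl v → x ≡ r × Free x)
        jump-outside {g} w∉k low = by low (v Fin.≟ g) (u Fin.≟ g)
          where
          gate : ¬ Free v
          gate fv = w∉k (sym (link-free′ fv vw))

          v≡tw : v ≡ tw w
          v≡tw with proj₂ vw
          ... | inj₁ eq = ⊥-elim (w∉k (sym eq))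
          ... | inj₂ eq = eq

          u∈k : cl u ≡ cl v
          u∈k with proj₂ uv
          ... | inj₁ eq = eq
          ... | inj₂ eq = ⊥-elim (w∉ (subst D (≡.trans eq (sym (tw-swap v≡tw))) u∈))

          old : ∀ {x} → D' x → cl x ≡ cl v → D x × x ≢ u × x ≢ v
          old d c with kept d
          ... | inj₁ refl = ⊥-elim (w∉k c)
          ... | inj₂ d' = d'

          by : Low (λ x → D x × x ≢ g) (cl v) → Dec (v ≡ g) → Dec (u ≡ g) →
            ∃[ r ] (∀ {x} → D' x → cl x ≡ cl v → x ≡ r × Free x)
          by _ (yes refl) (yes refl) = ⊥-elim (proj₁ uv refl)
          -- No peg remains in the cluster, so `v` is an arbitrary witness.
          by (inj₁ (q , f)) (yes refl) (no u≢g) = v , λ d c → let d' , x≢u , x≢v = old d c in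
            ⊥-elim (x≢u (≡.trans (f (d' , x≢v) c) (sym (f (u∈ , u≢g) u∈k))))
          by (inj₁ (q , f)) (no v≢g) (yes refl) = v , λ d c → let d' , x≢u , x≢v = old d c in
            ⊥-elim (x≢v (≡.trans (f (d' , x≢u) c) (sym (f (v∈ , v≢g) refl))))
          by (inj₁ (q , f)) (no v≢g) (no u≢g) =
            ⊥-elim (proj₁ uv (≡.trans (f (u∈ , u≢g) u∈k) (sym (f (v∈ , v≢g) refl))))
          by (inj₂ (z , z' , fz , fz' , f)) (no v≢g) _ with f (v∈ , v≢g) refl
          ... | inj₁ eq = ⊥-elim (gate (subst Free (sym eq) fz))
          ... | inj₂ eq = ⊥-elim (gate (subst Free (sym eq) fz'))
          by (inj₂ (z , z' , fz , fz' , f)) (yes refl) (no u≢g) =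
            let r , fr , is-r = other fz fz' (f (u∈ , u≢g) u∈k) in
            r , λ d c → let d' , x≢u , x≢v = old d c
                            eq = is-r x≢u (f (d' , x≢v) c)
                        in eq , subst Free (sym eq) fr

        -- The first jump over a peg of `s` turns the reserve into a surplus. The surplus then
        -- stays, moves on with an exported peg, or lands in the target cluster. A landed position
        -- only shrinks in the two clusters at the landing gate.
        safe-jump : Safe D → Safe D'
        safe-jump (landed g g∈o gate lows only free (r , one)) =
          landed g g∈o gate (low-else lows lows)
            (λ d c → only (shrinks (λ eq → v≢o (≡.trans (sym w∈) (≡.trans (sym eq) c))) d) c)
            (λ d c → free (shrinks (v≢i' c) d) c)
            (r , λ d c → one (shrinks (v≢i' c) d) c)
          where
          w∈ : cl w ≡ cl v
          w∈ = proj₁ (low-jump lows)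
          -- Jumping over the only peg `g` of the target cluster would require a peg on its twin,
          -- but all pegs facing `g` are free.
          v≢o : cl v ≢ o
          v≢o v∈o with refl ← only v∈ v∈o | proj₂ uv
          ... | inj₁ eq = proj₁ uv (only u∈ (≡.trans eq v∈o))
          ... | inj₂ eq = proj₁ uv (≡.trans (sym (free u∈ (cong cl eq))) (≡.trans (cong tw eq) (tw-invol v)))
          v≢i : cl v ≢ cl (tw g)
          v≢i v∈i = proj₁ uv (≡.trans (one u∈ (≡.trans (link-free (free v∈ v∈i) uv) v∈i)) (sym (one v∈ v∈i)))
          v≢i' : ∀ {x} → cl x ≡ cl (tw g) → cl x ≢ cl w
          v≢i' c eq = v≢i (≡.trans (sym w∈) (≡.trans (sym eq) c))
        safe-jump (reserve {ps} empty len frees cover lows) with cl v Fin.≟ s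
        ... | no v≢s = reserve (still-empty empty (λ eq → empty v∈ (≡.trans (sym w∈) eq))) len frees
          (λ d c → cover (shrinks (λ eq → v≢s (≡.trans (sym w∈) (≡.trans (sym eq) c))) d) c)
          (λ ne → low-else (lows v≢s) (lows ne))
          where
          w∈ : cl w ≡ cl v
          w∈ = proj₁ (low-jump (lows v≢s))
        ... | yes v∈s =
          surplus s w s≢o (still-empty empty (λ eq → s≢o (≡.trans (sym w∈s) eq)))
            (λ ne → elsewhere (λ eq → ne (≡.trans eq w∈s)) (lows ne))
            (two len₂ (Allₚ.─⁺ j (Allₚ.─⁺ i frees)) λ (d , x≢w) c → rest (kept d) x≢w c)
          where
          i : v ∈ₗ ps
          i = cover v∈ v∈s
          v-free : Free v
          v-free = All.lookup frees i
          w∈s : cl w ≡ s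
          w∈s = ≡.trans (sym (link-free′ v-free vw)) v∈s
          j : u ∈ₗ (ps ─ i)
          j = ∈-─ i (cover u∈ (≡.trans (link-free v-free uv) v∈s)) (proj₁ uv)
          len₂ : length (ps ─ i ─ j) ≡ 2
          len₂ = ℕ.suc-injective (≡.trans (length-─ j) (ℕ.suc-injective (≡.trans (length-─ i) len)))
          rest : ∀ {x} → x ≡ w ⊎ (D x × x ≢ u × x ≢ v) → x ≢ w → cl x ≡ s → x ∈ₗ (ps ─ i ─ j)
          rest (inj₁ eq) x≢w _ = ⊥-elim (x≢w eq)
          rest (inj₂ (d , x≢u , x≢v)) _ c = ∈-─ j (∈-─ i (cover d c) x≢v) x≢u
        safe-jump (surplus k g k≢o empty lows low) with cl v Fin.≟ k
        ... | no v≢k = surplus k g k≢o (still-empty empty (λ eq → empty v∈ (≡.trans (sym w∈) eq)))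
          (λ ne → low-else (lows v≢k) (lows ne))
          (low-anti (λ (d , x≢g) c → shrinks (λ eq → v≢k (≡.trans (sym w∈) (≡.trans (sym eq) c))) d , x≢g) low)
          where
          w∈ : cl w ≡ cl v
          w∈ = proj₁ (low-jump (lows v≢k))
        ... | yes refl with cl w Fin.≟ cl v
        ...   | yes w∈ = surplus k w k≢o (still-empty empty (λ eq → k≢o (≡.trans (sym w∈) eq)))
          (λ ne → elsewhere (λ eq → ne (≡.trans eq w∈)) (lows ne)) (jump-inside w∈ low)
        ...   | no w∉ with r , left ← jump-outside w∉ low | cl w Fin.≟ o
        ...     | no w≢o = surplus (cl w) w w≢o (still-empty empty w≢o) lows'
          (low-anti (λ (d , x≢w) c → old x≢w (kept d)) (lows w∉))
          where
          lows' : ∀ {j} → j ≢ cl w → Low D' j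
          lows' {j} ne with j Fin.≟ cl v
          ... | yes refl = inj₁ (r , λ d c → proj₁ (left d c))
          ... | no ne' = elsewhere ne (lows ne')
          old : ∀ {x} → x ≢ w → x ≡ w ⊎ (D x × x ≢ u × x ≢ v) → D x
          old x≢w (inj₁ eq) = ⊥-elim (x≢w eq)
          old x≢w (inj₂ (d , _)) = d
        ...     | yes w∈o = landed w w∈o (λ eq → w∉ (sym (≡.trans (cong cl v≡tw) (cong cl eq)))) lows'
          only
          (λ d c → proj₂ (left d (≡.trans c (sym (cong cl v≡tw)))))
          (r , λ d c → proj₁ (left d (≡.trans c (sym (cong cl v≡tw)))))
          where
          v≡tw : v ≡ tw w
          v≡tw with proj₂ vw
          ... | inj₁ eq = ⊥-elim (w∉ (sym eq))
          ... | inj₂ eq = eq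
          only : ∀ {x} → D' x → cl x ≡ o → x ≡ w
          only d c with kept d
          ... | inj₁ eq = eq
          ... | inj₂ (d' , _) = ⊥-elim (empty d' c)
          lows' : ∀ {j} → Low D' j
          lows' {j} with j Fin.≟ cl v | j Fin.≟ cl w
          ... | yes refl | _ = inj₁ (r , λ d c → proj₁ (left d c))
          ... | no _ | yes eq = inj₁ (w , λ d c → only d (≡.trans c (≡.trans eq w∈o)))
          ... | no ne | no ne' = elsewhere ne' (lows ne)

-- Subsets of prescribed size on an initial block of vertices.

x∉p-x : ∀ {n} (p : Subset n) x → x ∉ p - x
x∉p-x (inside ∷ p) zero ()
x∉p-x (outside ∷ p) zero ()
x∉p-x (_ ∷ p) (suc x) (Vec.there x∈) = x∉p-x p x x∈

subset-of-size : ∀ {n d} → d ≤ n → Σ (Subset n) λ p → ∣ p ∣ ≡ d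
subset-of-size {n} z≤n = ⊥ , Sub.∣⊥∣≡0 n
subset-of-size (s≤s d≤n) with p , eq ← subset-of-size d≤n = inside ∷ p , cong suc eq

pad : ∀ {n} m → Subset n → Subset (n + m)
pad m p = p Vec.++ ⊥

∣pad∣ : ∀ {n} m (p : Subset n) → ∣ pad m p ∣ ≡ ∣ p ∣
∣pad∣ m [] = Sub.∣⊥∣≡0 m
∣pad∣ m (inside ∷ p) = cong suc (∣pad∣ m p)
∣pad∣ m (outside ∷ p) = ∣pad∣ m p

∈-pad⁻ : ∀ {n} m (p : Subset n) {x} → x ∈ pad m p → ∃[ y ] x ≡ y ↑ˡ m
∈-pad⁻ m [] x∈ = ⊥-elim (Sub.∉⊥ x∈)
∈-pad⁻ m (_ ∷ p) Vec.here = zero , refl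
∈-pad⁻ m (_ ∷ p) (Vec.there x∈) with y , eq ← ∈-pad⁻ m p x∈ = suc y , cong suc eq

-- The concrete extremal graph, its parameters and its bad distributions.

module Extremal (b : ℕ) where

  a : ℕ
  a = suc (suc b)

  -- gate i j is joined to gate j i; gate i i is an ordinary vertex. The pegs labelled 0 are
  -- moved to cluster 1 by home, so that cluster 0 has none and cluster 1 has four.
  data Place : Set where
    peg  : Fin a → Fin 2 → Place
    gate : Fin a → Fin a → Place

  home : Place → Fin a
  home (peg zero _) = suc zero
  home (peg (suc j) _) = suc j
  home (gate i _) = i

  twin : Place → Place
  twin (peg j e) = peg j e
  twin (gate i j) = gate j i

  twin-invol : ∀ p → twin (twin p) ≡ p
  twin-invol (peg _ _) = refl
  twin-invol (gate _ _) = refl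

  -- The 2a peg places come first, so a distribution confined to them is a padded subset of an
  -- initial block.
  N : ℕ
  N = a * 2 + a * a

  abstract
    label : Fin (a * 2) ⊎ Fin (a * a) → Place
    label (inj₁ p) = uncurry peg (remQuot {a} 2 p)
    label (inj₂ g) = uncurry gate (remQuot {a} a g)

    place : Fin N → Place
    place x = label (splitAt (a * 2) x)

    index : Place → Fin N
    index (peg j e) = combine j e ↑ˡ (a * a)
    index (gate i j) = (a * 2) ↑ʳ combine i j

    place-index : ∀ p → place (index p) ≡ p
    place-index (peg j e) = ≡.trans (cong label (Fin.splitAt-↑ˡ (a * 2) (combine j e) (a * a)))
      (cong (uncurry peg) (Fin.remQuot-combine {a} {2} j e))
    place-index (gate i j) = ≡.trans (cong label (Fin.splitAt-↑ʳ (a * 2) (a * a) (combine i j)))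
      (cong (uncurry gate) (Fin.remQuot-combine {a} {a} i j))

    index-place : ∀ x → index (place x) ≡ x
    index-place x with splitAt (a * 2) x in eq
    ... | inj₁ p = ≡.trans (cong (_↑ˡ (a * a)) (Fin.combine-remQuot {a} 2 p)) (Fin.splitAt⁻¹-↑ˡ eq)
    ... | inj₂ g = ≡.trans (cong ((a * 2) ↑ʳ_) (Fin.combine-remQuot {a} a g)) (Fin.splitAt⁻¹-↑ʳ eq)

    index-peg : ∀ y → y ↑ˡ (a * a) ≡ index (peg (proj₁ (remQuot {a} 2 y)) (proj₂ (remQuot {a} 2 y)))
    index-peg y = sym (cong (_↑ˡ (a * a)) (Fin.combine-remQuot {a} 2 y))

  cl : Fin N → Fin a
  cl x = home (place x)

  tw : Fin N → Fin N
  tw x = index (twin (place x))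

  tw-invol : ∀ x → tw (tw x) ≡ x
  tw-invol x = ≡.trans (cong (λ p → index (twin p)) (place-index (twin (place x))))
    (≡.trans (cong index (twin-invol (place x))) (index-place x))

  open Cliques cl tw tw-invol

  cl-index : ∀ p → cl (index p) ≡ home p
  cl-index p = cong home (place-index p)

  tw-index : ∀ p → tw (index p) ≡ index (twin p)
  tw-index p = cong (λ q → index (twin q)) (place-index p)

  index-injective : ∀ {p q} → index p ≡ index q → p ≡ q
  index-injective {p} {q} eq = ≡.trans (sym (place-index p)) (≡.trans (cong place eq) (place-index q))

  t : Fin N
  t = index (gate zero zero)

  open Stuck zero t (tw-index (gate zero zero)) (cl-index (gate zero zero))

  peg-free : ∀ j e → Free (index (peg j e))
  peg-free j e = tw-index (peg j e)

  -- One step to the gate facing the other clique, one across, and one inside that clique.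
  distances : ∀ x y → DistLe graph x y 3
  distances x y with cl x Fin.≟ cl y
  ... | yes eq with j , j≤ , w ← dist-same eq = j , ℕ.≤-trans j≤ (s≤s z≤n) , w
  ... | no ne = dist-+ {1} {2} (dist-same (sym (cl-index g)))
    (dist-+ {1} {1}
      (1 , s≤s z≤n , step (link⇒adj {index g} {index h} (g≢h , inj₂ (sym (tw-index h)))) here)
      (dist-same (cl-index h)))
    where
    g h : Place
    g = gate (cl x) (cl y)
    h = gate (cl y) (cl x)
    g≢h : index g ≢ index h
    g≢h eq = ne (≡.trans (sym (cl-index g)) (≡.trans (cong cl eq) (cl-index h)))

  far-from-t : ∀ {e k} → DistLe graph t (index (peg zero e)) k → 3 ≤ k
  far-from-t {e} = free-far (tw-index (gate zero zero)) (peg-free zero e)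
    (λ eq → Fin.0≢1+n (≡.trans (sym (cl-index (gate zero zero))) (≡.trans eq (cl-index (peg zero e)))))

  diameter : HasDiam graph 3
  diameter = distances , t , index (peg zero zero) , distances t (index (peg zero zero)) , λ _ → far-from-t

  ve-diameter : HasVEDiam graph 3
  ve-diameter = (p₀ , p₁ , edge₀₁) , (λ x u v _ → inj₁ (distances x u)) ,
    -- Both ends of this edge are free vertices outside the clique of `t`, so neither is closer than
    -- three.
    t , p₀ , p₁ , edge₀₁ , λ _ → λ { (inj₁ d) → far-from-t d ; (inj₂ d) → far-from-t d }
    where
    p₀ p₁ : Fin N
    p₀ = index (peg zero zero)
    p₁ = index (peg zero (suc zero))
    edge₀₁ : Adj graph p₀ p₁
    edge₀₁ = link⇒adj {p₀} {p₁}
      ((λ eq → case-absurd (index-injective {peg zero zero} {peg zero (suc zero)} eq)) ,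
       inj₁ (≡.trans (cl-index (peg zero zero)) (sym (cl-index (peg zero (suc zero))))))
      where
      case-absurd : peg zero zero ≢ peg zero (suc zero)
      case-absurd ()

  independence : HasIndepNum graph a
  independence = (fromList spares , spares-independent ,
      ℕ.≤-antisym (independent-small (fromList spares) spares-independent)
        (subst (_≤ ∣ fromList spares ∣) (≡.trans (List.length-map spare (allFin a))
            (List.length-tabulate {n = a} (λ i → i)))
          (length≤∣fromList∣ (Uniqueₚ.map⁺ spare-injective (Uniqueₚ.allFin⁺ a))))) ,
    independent-small
    where
    spare : Fin a → Fin N
    spare i = index (gate i i)
    spares : List (Fin N)
    spares = map spare (allFin a)
    spare-injective : ∀ {i j} → spare i ≡ spare j → i ≡ j
    spare-injective {i} {j} eq = cong home (index-injective {gate i i} {gate j j} eq)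
    spares-independent : Independent graph (fromList spares)
    spares-independent x y x∈ y∈ xy
      with i , _ , refl ← ∈-map⁻ spare (∈-fromList⁻ spares x∈)
         | j , _ , refl ← ∈-map⁻ spare (∈-fromList⁻ spares y∈) =
      proj₁ (adj⇒link {spare i} {spare j} xy) (cong spare (≡.trans (sym (cl-index (gate i i)))
        (≡.trans (link-free (tw-index (gate j j)) (adj⇒link {spare i} {spare j} xy)) (cl-index (gate j j)))))

  one≢zero : _≢_ {A = Fin a} (suc zero) zero
  one≢zero ()

  -- Cluster one receives the pegs labelled 0 and 1, hence at most four free ones; every other
  -- cluster has at most two. Subsets of the peg places are covered as well.
  initial : ∀ {D : Fin N → Set} → (∀ {x} → D x → ∃[ j ] ∃[ e ] x ≡ index (peg j e)) → Safe (suc zero) one≢zero D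
  initial {D} pegs =
    reserve {ps = ps} empty refl (peg-free _ _ ∷ peg-free _ _ ∷ peg-free _ _ ∷ peg-free _ _ ∷ []) cover lows
    where
    ps : List (Fin N)
    ps = index (peg zero zero) ∷ index (peg zero (suc zero)) ∷
         index (peg (suc zero) zero) ∷ index (peg (suc zero) (suc zero)) ∷ []
    home≢0 : ∀ j {e} → home (peg j e) ≢ zero
    home≢0 zero ()
    home≢0 (suc j) ()
    empty : Empty D
    empty d c with j , e , refl ← pegs d = home≢0 j (≡.trans (sym (cl-index (peg j e))) c)
    peg∈ps : ∀ j e → home (peg j e) ≡ suc zero → index (peg j e) ∈ₗ ps
    peg∈ps zero zero _ = here refl
    peg∈ps zero (suc zero) _ = there (here refl)
    peg∈ps (suc zero) zero refl = there (there (here refl))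
    peg∈ps (suc zero) (suc zero) refl = there (there (there (here refl)))
    cover : ∀ {x} → D x → cl x ≡ suc zero → x ∈ₗ ps
    cover d c with j , e , refl ← pegs d = peg∈ps j e (≡.trans (sym (cl-index (peg j e))) c)
    low-peg : ∀ j e {k} → k ≢ suc zero → home (peg j e) ≡ k →
      index (peg j e) ≡ index (peg k zero) ⊎ index (peg j e) ≡ index (peg k (suc zero))
    low-peg zero _ ne eq = ⊥-elim (ne (sym eq))
    low-peg (suc j) zero _ refl = inj₁ refl
    low-peg (suc j) (suc zero) _ refl = inj₂ refl
    lows : ∀ {k} → k ≢ suc zero → Low D k
    lows {k} ne = inj₂ (index (peg k zero) , index (peg k (suc zero)) ,
      peg-free k zero , peg-free k (suc zero) , pair-of)
      where
      pair-of : ∀ {x} → D x → cl x ≡ k → x ≡ index (peg k zero) ⊎ x ≡ index (peg k (suc zero))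
      pair-of d c with j , e , refl ← pegs d = low-peg j e ne (≡.trans (sym (cl-index (peg j e))) c)

  move⇒jump : ∀ {D D'} → Move graph D D' → Jump (_∈ D) (_∈ D')
  move⇒jump {D} (u , v , w , u∈ , v∈ , uv , w∉ , vw , refl) = record
    { u∈ = u∈ ; v∈ = v∈ ; w∉ = w∉ ; uv = adj⇒link {u} {v} uv ; vw = adj⇒link {v} {w} vw
    ; kept = λ x∈ → old (Sub.x∈p∪q⁻ _ _ x∈)
    }
    where
    old : ∀ {x} → x ∈ (D - u) - v ⊎ x ∈ ⁅ w ⁆ → x ≡ w ⊎ (x ∈ D × x ≢ u × x ≢ v)
    old (inj₂ x∈) = inj₁ (Sub.x∈⁅y⁆⇒x≡y w x∈)
    old (inj₁ x∈) = inj₂ (Sub.p─q⊆p D ⁅ u ⁆ x∈D-u , (λ { refl → x∉p-x D u x∈D-u }) ,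
      (λ { refl → x∉p-x (D - u) v x∈ }))
      where
      x∈D-u = Sub.p─q⊆p (D - u) ⁅ v ⁆ x∈

  moves-safe : ∀ {k D D'} → Moves graph k D D' →
    Safe (suc zero) one≢zero (_∈ D) → Safe (suc zero) one≢zero (_∈ D')
  moves-safe done S = S
  moves-safe (more m ms) S = moves-safe ms (safe-jump (suc zero) one≢zero (move⇒jump m) S)

  pad-pegs : ∀ p {x} → x ∈ pad (a * a) p → ∃[ j ] ∃[ e ] x ≡ index (peg j e)
  pad-pegs p x∈ with y , refl ← ∈-pad⁻ (a * a) p x∈ =
    proj₁ (remQuot {a} 2 y) , proj₂ (remQuot {a} 2 y) ,
    index-peg y

  -- Any selection of the 2a peg places starts in a safe state, so one construction defeats every
  -- `d` up to 2a.
  few-pegs-fail : ∀ d → d < 2 * a + 1 → ¬ AllReach graph d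
  few-pegs-fail d d< reach =
    let p , ∣p∣≡d = subset-of-size {a * 2} (s≤s⁻¹ (subst (d <_)
          (≡.trans (ℕ.+-comm (2 * a) 1) (cong suc (ℕ.*-comm 2 a))) d<))
        _ , _ , ms , t∈ = reach (pad (a * a) p) (≡.trans (∣pad∣ (a * a) p) ∣p∣≡d) t
    in safe-misses (suc zero) one≢zero (moves-safe ms (initial (pad-pegs p))) t∈

-- The pegging number as a least witness, and the assembly.

least : ∀ {P : ℕ → Set} → (∀ d → Dec (P d)) → ∀ k {p} → 1 ≤ p → (∀ d → 1 ≤ d → d < p → ¬ P d) →
  P (k + p) → ∃[ q ] ((1 ≤ q × P q × (∀ d → 1 ≤ d → d < q → ¬ P d)) × q ≤ k + p)
least P? zero 1≤p below Pp = _ , (1≤p , Pp , below) , ℕ.≤-refl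
least {P} P? (suc k) {p} 1≤p below Pk+p with P? p
... | yes Pp = p , (1≤p , Pp , below) , ℕ.m≤n+m p (suc k)
... | no ¬Pp =
  let q , minimal , q≤ = least P? k (s≤s z≤n) below' (subst P (sym (ℕ.+-suc k p)) Pk+p)
  in q , minimal , subst (q ≤_) (ℕ.+-suc k p) q≤
  where
  below' : ∀ d → 1 ≤ d → d < suc p → ¬ P d
  below' d 1≤d d<1+p Pd with d ℕ.≟ p
  ... | yes refl = ¬Pp Pd
  ... | no d≢p = below d 1≤d (ℕ.≤∧≢⇒< (s≤s⁻¹ d<1+p) d≢p) Pd

reach-within-seven : ∀ {n a} (G : Graph n) → HasVEDiam G 3 → HasIndepNum G a →
  ∀ D → 2 * a + 1 ≤ ∣ D ∣ → ∀ t → ReachableWithin G 7 D t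
reach-within-seven G (_ , ve , _) (_ , α) = Upper.upper G ve α

enough-pegs : ∀ {n a} (G : Graph n) → HasVEDiam G 3 → HasIndepNum G a → AllReach G (2 * a + 1)
enough-pegs G ved ind D eq t =
  let k , D' , _ , ms , t∈ = reach-within-seven G ved ind D (ℕ.≤-reflexive (sym eq)) t
  in k , D' , ms , t∈

theorem6p4 : (a : ℕ) → 2 ≤ a →
    ((n : ℕ) (G : Graph n) → HasVEDiam G 3 → HasIndepNum G a →
    ∃[ p ] (HasPeggingNum G p × p ≤ 2 * a + 1))
    × (∃[ n ] ∃[ G ] (HasDiam {n} G 3 × HasVEDiam G 3 × HasIndepNum G a
    × HasPeggingNum G (2 * a + 1)))
    × ((n : ℕ) (G : Graph n) → HasVEDiam G 3 → HasIndepNum G a →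
    ∀ (D : Subset n) → 2 * a + 1 ≤ ∣ D ∣ → ∀ (t : Fin n) → ReachableWithin G 7 D t)
theorem6p4 (suc (suc b)) (s≤s (s≤s _)) =
  -- The search starts at 1, where nothing smaller has to be excluded, and has 2a further
  -- candidates, ending at 2a + 1.
  (λ n G ved ind → least (Pegging.allReach? G) (2 * a) {1} ℕ.≤-refl
    (λ d 1≤d d<1 → ⊥-elim (ℕ.<⇒≱ d<1 1≤d)) (enough-pegs G ved ind)) ,
  (_ , Cliques.graph cl tw tw-invol , diameter , ve-diameter , independence ,
    ℕ.m≤n+m 1 (2 * a) , enough-pegs _ ve-diameter independence , λ d _ → few-pegs-fail d) ,
  λ n G → reach-within-seven G
  where open Extremal b
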